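{- In the graceful game, Bob has a winning strategy on every caterpillar with diameter at least three (no matter who starts).
   Context: A caterpillar $cat(k_1,\dots,k_s)$ is the tree obtained from a path $(v_1,\dots,v_s)$ (the spine) by attaching $k_j$ new leaf vertices to $v_j$ for each $j$. A graceful labeling of a graph $G$ with $m$ edges is an injective map $f\colon V(G)\to\{0,1,\dots,m\}$ such that the induced edge labels $|f(u)-f(v)|$, $uv\in E(G)$, are pairwise distinct. The graceful game on a simple graph $G$ with $m$ edges: two players, Alice and Bob, alternately choose a free (not yet labeled) vertex and assign to it a label from $\{0,1,\dots,m\}$ not yet used. An edge both of whose endpoints are labeled gets label $|f(u)-f(v)|$; a move is legal only if after it all edge labels are pairwise distinct. Alice wins if the whole graph ends up gracefully labeled; Bob wins if he can prevent this. Either player may be the first to move. -}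

module Defs where

open import Data.Nat using (ℕ; zero; suc; _≤_; ∣_-_∣)
open import Data.Fin using (Fin; inject₁) renaming (suc to fsuc)
open import Data.Fin.Properties using () renaming (_≟_ to _≟F_)
open import Data.Vec using (Vec; lookup; sum)
open import Data.Maybe using (Maybe; just; nothing)
open import Data.Product using (Σ; ∃; ∃-syntax; _×_; _,_)
open import Data.Sum using (_⊎_; inj₁; inj₂)
import Data.Sum.Properties as SumP
import Data.Product.Properties as ProdP
open import Relation.Nullary using (¬_; yes; no)
open import Relation.Binary.PropositionalEquality using (_≡_; _≢_)
open import Relation.Binary using (DecidableEquality)

-- A finite graph given by a vertex type, an edge type with endpoints,
-- and the number of edges m (= size of the edge type, by construction).
record Graph : Set₁ where
  field
    V     : Set
    _≟V_  : DecidableEquality V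
    E     : Set
    ends  : E → V × V
    m     : ℕ

-- Caterpillar cat(k_1,…,k_s), spine length s = suc t (s ≥ 1).

CatV : {t : ℕ} → Vec ℕ (suc t) → Set
CatV {t} ks = Fin (suc t) ⊎ Σ (Fin (suc t)) (λ j → Fin (lookup ks j))
-- inj₁ j          : spine vertex v_j
-- inj₂ (j , i)    : i-th leaf attached to v_j

CatE : {t : ℕ} → Vec ℕ (suc t) → Set
CatE {t} ks = Fin t ⊎ Σ (Fin (suc t)) (λ j → Fin (lookup ks j))

catEnds : {t : ℕ} (ks : Vec ℕ (suc t)) → CatE ks → CatV ks × CatV ks
catEnds ks (inj₁ i)       = inj₁ (inject₁ i) , inj₁ (fsuc i)
catEnds ks (inj₂ (j , i)) = inj₁ j , inj₂ (j , i)

catDecEq : {t : ℕ} (ks : Vec ℕ (suc t)) → DecidableEquality (CatV ks)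
catDecEq ks = SumP.≡-dec _≟F_ (ProdP.≡-dec _≟F_ _≟F_)

cat : {t : ℕ} → Vec ℕ (suc t) → Graph
cat {t} ks = record
  { V = CatV ks ; _≟V_ = catDecEq ks ; E = CatE ks ; ends = catEnds ks
  ; m = t Data.Nat.+ sum ks }

data Player : Set where
  Alice Bob : Player

module _ (G : Graph) where
  open Graph G

  Adj : V → V → Set
  Adj u v = ∃[ e ] (ends e ≡ (u , v) ⊎ ends e ≡ (v , u))

  DistGe3 : V → V → Set
  DistGe3 u v = u ≢ v × ¬ Adj u v × ¬ (∃[ w ] (Adj u w × Adj w v))

  DiamGe3 : Set
  DiamGe3 = ∃[ u ] ∃[ v ] DistGe3 u v

  Labeling : Set
  Labeling = V → Maybe ℕ

  assign : Labeling → V → ℕ → Labeling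
  assign f v l w with w ≟V v
  ... | yes _ = just l
  ... | no  _ = f w

  EdgeLabelsDistinct : Labeling → Set
  EdgeLabelsDistinct f =
    ∀ e e' → e ≢ e' →
    ∀ {a b a' b'} → ends e ≡ (a , b) → ends e' ≡ (a' , b') →
    ∀ {x y x' y'} → f a ≡ just x → f b ≡ just y → f a' ≡ just x' → f b' ≡ just y' →
    ∣ x - y ∣ ≢ ∣ x' - y' ∣

  Legal : Labeling → V → ℕ → Set
  Legal f v l = f v ≡ nothing × l ≤ m × (∀ w → f w ≢ just l)
              × EdgeLabelsDistinct (assign f v l)

  Complete : Labeling → Set
  Complete f = ∀ v → ∃[ l ] (f v ≡ just l)

  Stuck : Labeling → Set
  Stuck f = ∀ v l → ¬ Legal f v l

  empty : Labeling
  empty _ = nothing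

  -- BobWins p f : Bob has a winning strategy from position f with p to move.
  -- The game ends when the player to move has no legal move; Alice wins iff
  -- at that point every vertex is labeled (then the labeling is graceful).
  data BobWins : Player → Labeling → Set where
    bob-move  : ∀ {f} v l → Legal f v l → BobWins Alice (assign f v l) → BobWins Bob f
    bob-stuck : ∀ {f} → ¬ Complete f → Stuck f → BobWins Bob f
    alice     : ∀ {f} → ¬ Complete f →
                (∀ v l → Legal f v l → BobWins Bob (assign f v l)) → BobWins Alice f

{-# OPTIONS --safe #-}
module Submission where

-- The proof works in any tree with m ≥ 3 edges having leaves v, v′ with distinct neighbours u, u′.
-- A graceful labelling uses every vertex label 0..m and every edge label 1..m.  The edge label m
-- forces 0 and m to be adjacent, so a leaf v labelled 0 forces m at its neighbour u; then the edge
-- label m − 1 forces 1 to be a neighbour of u.  Bob therefore labels v with 0 and next plays m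
-- away from u, or 1 away from the neighbours of u: no graceful completion remains, and he
-- only has to keep making legal moves.
--
-- When Alice opens with l at w, one of the two spoiling moves may be illegal or impossible.
-- Up to the symmetry l ↦ m − l one may assume 2l ≠ m + 1, and the exceptions are then: w at the
-- end of the long leg of a spider (all other vertices adjacent to u), where 1 at the neighbour
-- of w leaves the label m + 1 − l without a place; and the five-vertex path opened at an end
-- with 2, where Bob plays 0 next to w.

open import Defs
open import Data.Nat using (ℕ; zero; suc; pred; _+_; _∸_; _≤_; _<_; z≤n; s≤s; ∣_-_∣)
open import Data.Nat.Properties as ℕ using (≤-refl; ≤-trans; ≤-antisym; ≤-reflexive; +-comm; +-assoc; +-suc; suc-injective)
open import Data.Fin as Fin using (Fin; toℕ; fromℕ; fromℕ<; inject₁; punchOut)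
open import Data.Fin.Properties as Fin using (any?; all?)
open import Data.Vec as Vec using (Vec; []; _∷_)
open import Data.Maybe using (Maybe; just; nothing)
open import Data.Maybe.Properties using (just-injective)
import Data.Maybe.Properties as Maybe
open import Data.Product using (Σ; ∃; ∃-syntax; _×_; _,_; proj₁; proj₂)
open import Data.Product.Properties using (,-injectiveˡ; ,-injectiveʳ)
import Data.Product.Properties as Product
open import Data.Sum using (_⊎_; inj₁; inj₂; [_,_])
open import Data.Sum.Properties using (inj₁-injective)
open import Data.Sum.Function.Propositional using (_⊎-↔_)
open import Data.Empty using (⊥; ⊥-elim)
open import Data.List using (List; []; _∷_; length; lookup)
open import Data.List.Membership.Propositional using (_∈_; _∉_)
open import Data.List.Membership.Propositional.Properties using (∈-lookup; ∈-map⁺)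
open import Data.List.Membership.Setoid.Properties using (index-injective)
open import Data.List.Relation.Unary.Any using (here; there; index)
open import Data.List.Relation.Unary.All as All using (All; []; _∷_)
open import Data.List.Relation.Unary.AllPairs using ([]; _∷_)
open import Data.List.Relation.Unary.Unique.Propositional using (Unique)
open import Function using (_∘_; _↔_; Inverse; Injective; mk↔ₛ′)
open import Function.Construct.Composition using (_↔-∘_)
open import Function.Construct.Identity using (↔-id)
open import Relation.Nullary using (¬_; Dec; yes; no; contradiction; map′; ¬?; _×-dec_; _⊎-dec_; _→-dec_)
open import Relation.Nullary.Decidable using (decidable-stable)
open import Relation.Binary.PropositionalEquality using (_≡_; _≢_; refl; sym; trans; cong; cong₂; subst; subst₂; setoid)

-- Pigeonhole and absolute differences

-- If `k` were missed, punching it out would inject `n` elements into `n - 1` places.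
injective⇒onto : ∀ {n} (h : Fin n → ℕ) → (∀ i → h i < n) → (∀ {i j} → h i ≡ h j → i ≡ j) →
                 ∀ {k} → k < n → ∃[ i ] h i ≡ k
injective⇒onto {suc n} h h< inj {k} k<n with any? (λ i → h i ℕ.≟ k)
... | yes p = p
... | no ¬p = ⊥-elim (ℕ.1+n≰n (Fin.injective⇒≤ punched-injective))
  where
  k′ = fromℕ< k<n
  h′ : Fin (suc n) → Fin (suc n)
  h′ i = fromℕ< (h< i)
  avoids : ∀ i → k′ ≢ h′ i
  avoids i eq = ¬p (i , sym (trans (sym (Fin.toℕ-fromℕ< k<n)) (trans (cong toℕ eq) (Fin.toℕ-fromℕ< (h< i)))))
  punched-injective : Injective _≡_ _≡_ (λ i → punchOut (avoids i))
  punched-injective {i} {j} eq =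
    inj (trans (sym (Fin.toℕ-fromℕ< (h< i)))
        (trans (cong toℕ (Fin.punchOut-injective (avoids i) (avoids j) eq)) (Fin.toℕ-fromℕ< (h< j))))

∣-∣-cases : ∀ x y → (y ≡ x + ∣ x - y ∣) ⊎ (x ≡ y + ∣ x - y ∣)
∣-∣-cases zero    y       = inj₁ refl
∣-∣-cases (suc x) zero    = inj₂ refl
∣-∣-cases (suc x) (suc y) = Data.Sum.map (cong suc) (cong suc) (∣-∣-cases x y)

∣-∣-mono-≤ : ∀ {x y n} → x ≤ n → y ≤ n → ∣ x - y ∣ ≤ n
∣-∣-mono-≤ {x} {y} x≤n y≤n = ≤-trans (ℕ.∣m-n∣≤m⊔n x y) (ℕ.⊔-lub x≤n y≤n)

-- Reflection is an isometry. The form with sums leaves the centre free: besides `l ↦ m - l` it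
-- serves to turn `k + k ≡ m + j` into an equality of edge labels at a vertex labelled `k`.
∣-∣-reflect : ∀ {n} x y {x′ y′} → x + x′ ≡ n → y + y′ ≡ n → ∣ x - y ∣ ≡ ∣ x′ - y′ ∣
∣-∣-reflect zero    zero    {x′} {y′} p q = sym (ℕ.m≡n⇒∣m-n∣≡0 {x′} {y′} (trans p (sym q)))
∣-∣-reflect zero    (suc y) {x′} {y′} p q =
  sym (trans (cong ∣_- y′ ∣ (trans p (trans (sym q) (+-comm (suc y) y′))))
      (trans (ℕ.∣-∣-comm (y′ + suc y) y′) (ℕ.∣m-m+n∣≡n y′ (suc y))))
∣-∣-reflect (suc x) zero    {x′} {y′} p q =
  sym (trans (cong ∣ x′ -_∣ (trans q (trans (sym p) (+-comm (suc x) x′)))) (ℕ.∣m-m+n∣≡n x′ (suc x)))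
∣-∣-reflect {suc n} (suc x) (suc y) p q = ∣-∣-reflect x y (suc-injective p) (suc-injective q)

-- The reason why playing `m` never gives two new edges the same label.
∣x-n∣-injective : ∀ {x y n} → x ≤ n → y ≤ n → ∣ x - n ∣ ≡ ∣ y - n ∣ → x ≡ y
∣x-n∣-injective {x} {y} {n} x≤n y≤n eq =
  ℕ.∸-cancelˡ-≡ x≤n y≤n (trans (sym (ℕ.m≤n⇒∣m-n∣≡n∸m x≤n)) (trans eq (ℕ.m≤n⇒∣m-n∣≡n∸m y≤n)))

-- Positions, doomed positions and mirror symmetry

module Position (G : Graph) where
  open Graph G
  open import Data.List.Membership.DecPropositional _≟V_ public using (_∈?_)

  assign-same : ∀ f v l → assign G f v l v ≡ just l
  assign-same f v l with v ≟V v
  ... | yes _ = refl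
  ... | no v≢v = contradiction refl v≢v

  assign-other : ∀ f {v a} l → a ≢ v → assign G f v l a ≡ f a
  assign-other f {v} {a} l a≢v with a ≟V v
  ... | yes a≡v = contradiction a≡v a≢v
  ... | no _ = refl

  assign-inv : ∀ f v l {a x} → assign G f v l a ≡ just x → (a ≡ v × x ≡ l) ⊎ (a ≢ v × f a ≡ just x)
  assign-inv f v l {a} eq with a ≟V v
  ... | yes a≡v = inj₁ (a≡v , sym (just-injective eq))
  ... | no a≢v = inj₂ (a≢v , eq)

  assign-free : ∀ f v l {a} → assign G f v l a ≡ nothing → a ≢ v × f a ≡ nothing
  assign-free f v l {a} eq with a ≟V v
  ... | no a≢v = a≢v , eq

  Joins : E → V → V → Set
  Joins e a b = ends e ≡ (a , b) ⊎ ends e ≡ (b , a)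

  Adj-sym : ∀ {a b} → Adj G a b → Adj G b a
  Adj-sym (e , inj₁ p) = e , inj₂ p
  Adj-sym (e , inj₂ p) = e , inj₁ p

  record Valid (f : Labeling G) : Set where
    field
      bounded   : ∀ {a x} → f a ≡ just x → x ≤ m
      injective : ∀ {a b x} → f a ≡ just x → f b ≡ just x → a ≡ b
      distinct  : EdgeLabelsDistinct G f

  valid-empty : Valid (empty G)
  valid-empty = record { bounded = λ () ; injective = λ () ; distinct = λ _ _ _ _ _ () }

  valid-assign : ∀ {f v l} → Valid f → Legal G f v l → Valid (assign G f v l)
  valid-assign {f} {v} {l} val (_ , l≤m , fresh , dist) = record
    { bounded = bounded′ ; injective = injective′ ; distinct = dist }
    where
    open Valid val
    bounded′ : ∀ {a x} → assign G f v l a ≡ just x → x ≤ m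
    bounded′ p with assign-inv f v l p
    ... | inj₁ (_ , refl) = l≤m
    ... | inj₂ (_ , q) = bounded q
    injective′ : ∀ {a b x} → assign G f v l a ≡ just x → assign G f v l b ≡ just x → a ≡ b
    injective′ p q with assign-inv f v l p | assign-inv f v l q
    ... | inj₁ (a≡v , _)  | inj₁ (b≡v , _)  = trans a≡v (sym b≡v)
    ... | inj₁ (_ , refl) | inj₂ (_ , q′)   = contradiction q′ (fresh _)
    ... | inj₂ (_ , p′)   | inj₁ (_ , refl) = contradiction p′ (fresh _)
    ... | inj₂ (_ , p′)   | inj₂ (_ , q′)   = injective p′ q′

  record Graceful (g : V → ℕ) : Set where
    field
      bounded   : ∀ a → g a ≤ m
      injective : ∀ {a b} → g a ≡ g b → a ≡ b
      distinct  : EdgeLabelsDistinct G (just ∘ g)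

  Extends : (V → ℕ) → Labeling G → Set
  Extends g f = ∀ {a x} → f a ≡ just x → g a ≡ x

  -- The invariant behind Bob's play. It survives every later move, since a labelling that extends
  -- the later position also extends the earlier one.
  Doomed : Labeling G → Set
  Doomed f = ∀ {g} → Graceful g → Extends g f → ⊥

  extends-assign : ∀ {f v l g} → f v ≡ nothing → Extends g (assign G f v l) → g v ≡ l × Extends g f
  extends-assign {f} {v} {l} free ext = ext (assign-same f v l) , λ {a} p →
    ext (trans (assign-other f l λ { refl → case-nothing (trans (sym free) p) }) p)
    where
    case-nothing : ∀ {x : ℕ} → nothing ≢ just x
    case-nothing ()

  doomed-assign : ∀ {f v l} → f v ≡ nothing → Doomed f → Doomed (assign G f v l)
  doomed-assign free doom gr ext = doom gr (proj₂ (extends-assign free ext))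

  -- A complete valid position would itself be a graceful labelling that extends `f`.
  doomed-incomplete : ∀ {f} → Valid f → Doomed f → ¬ Complete G f
  doomed-incomplete {f} val doom total = doom {g} record
      { bounded = λ a → bounded (g-eq a)
      ; injective = λ {a} {b} eq → injective (g-eq a) (trans (g-eq b) (cong just (sym eq)))
      ; distinct = λ e e′ e≢e′ p q {x} {y} {x′} {y′} x≡ y≡ x′≡ y′≡ →
          distinct e e′ e≢e′ p q (trans (g-eq _) x≡) (trans (g-eq _) y≡) (trans (g-eq _) x′≡) (trans (g-eq _) y′≡) }
      λ {a} p → just-injective (trans (sym (g-eq a)) p)
    where
    open Valid val
    g : V → ℕ
    g a = proj₁ (total a)
    g-eq : ∀ a → f a ≡ just (g a)
    g-eq a = proj₂ (total a)

  -- A pointwise relation rather than a map on labelings, so that it passes through `assign` without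
  -- function extensionality.
  Mirror : Labeling G → Labeling G → Set
  Mirror f f′ = ∀ a → (f a ≡ nothing × f′ a ≡ nothing) ⊎
                      (∃[ x ] ∃[ y ] f a ≡ just x × f′ a ≡ just y × x + y ≡ m)

  mirror-sym : ∀ {f f′} → Mirror f f′ → Mirror f′ f
  mirror-sym mir a with mir a
  ... | inj₁ (p , q) = inj₁ (q , p)
  ... | inj₂ (x , y , p , q , eq) = inj₂ (y , x , q , p , trans (+-comm y x) eq)

  mirror-just : ∀ {f f′} → Mirror f f′ → ∀ {a y} → f′ a ≡ just y → ∃[ x ] f a ≡ just x × x + y ≡ m
  mirror-just mir {a} eq with mir a
  ... | inj₁ (_ , q) = contradiction (trans (sym q) eq) λ ()
  ... | inj₂ (x , y , p , q , x+y≡m) with just-injective (trans (sym q) eq)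
  ...   | refl = x , p , x+y≡m

  mirror-nothing : ∀ {f f′} → Mirror f f′ → ∀ {a} → f a ≡ nothing → f′ a ≡ nothing
  mirror-nothing mir {a} eq with mir a
  ... | inj₁ (_ , q) = q
  ... | inj₂ (_ , _ , p , _) = contradiction (trans (sym eq) p) λ ()

  mirror-assign : ∀ {f f′ v l l′} → Mirror f f′ → l + l′ ≡ m → Mirror (assign G f v l) (assign G f′ v l′)
  mirror-assign {v = v} mir eq a with a ≟V v
  ... | yes _ = inj₂ (_ , _ , refl , refl , eq)
  ... | no _ = mir a

  mirror-distinct : ∀ {f f′} → Mirror f f′ → EdgeLabelsDistinct G f → EdgeLabelsDistinct G f′
  mirror-distinct mir dist e e′ e≢e′ p q {x} {y} {x′} {y′} x≡ y≡ x′≡ y′≡ eq =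
    let (x₁ , x≡₁ , s₁) = mirror-just mir x≡
        (y₁ , y≡₁ , s₂) = mirror-just mir y≡
        (x₂ , x′≡₁ , s₃) = mirror-just mir x′≡
        (y₂ , y′≡₁ , s₄) = mirror-just mir y′≡
    in dist e e′ e≢e′ p q x≡₁ y≡₁ x′≡₁ y′≡₁
         (trans (∣-∣-reflect x₁ y₁ {x} {y} s₁ s₂) (trans eq (sym (∣-∣-reflect x₂ y₂ {x′} {y′} s₃ s₄))))

  mirror-legal : ∀ {f f′ v l l′} → Mirror f f′ → l + l′ ≡ m → Legal G f v l → Legal G f′ v l′
  mirror-legal {f} {f′} {v} {l} {l′} mir eq (free , l≤m , fresh , dist) =
      mirror-nothing mir free
    , subst (l′ ≤_) eq (ℕ.m≤n+m l′ l)
    , (λ a p → let (x , q , eq′) = mirror-just mir p in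
        fresh a (trans q (cong just (ℕ.+-cancelʳ-≡ l′ x l (trans eq′ (sym eq))))))
    , mirror-distinct (mirror-assign mir eq) dist

  mirror-complete : ∀ {f f′} → Mirror f f′ → Complete G f′ → Complete G f
  mirror-complete mir total a = let (x , p , _) = mirror-just mir (proj₂ (total a)) in x , p

  -- Complementing all labels preserves edge labels. Bob replays his strategy with `m ∸ l` for `l`,
  -- and Alice's moves are pulled back in the same way.
  bobWins-mirror : ∀ {p f f′} → Mirror f f′ → BobWins G p f → BobWins G p f′
  bobWins-mirror mir (bob-move v l legal wins) =
    let eq = ℕ.m+[n∸m]≡n (proj₁ (proj₂ legal)) in
    bob-move v (m ∸ l) (mirror-legal mir eq legal) (bobWins-mirror (mirror-assign mir eq) wins)
  bobWins-mirror mir (bob-stuck incomplete stuck) =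
    bob-stuck (incomplete ∘ mirror-complete mir) λ v l legal →
      stuck v (m ∸ l) (mirror-legal (mirror-sym mir) (ℕ.m+[n∸m]≡n (proj₁ (proj₂ legal))) legal)
  bobWins-mirror mir (alice incomplete reply) =
    alice (incomplete ∘ mirror-complete mir) λ v l legal →
      let eq = ℕ.m+[n∸m]≡n (proj₁ (proj₂ legal)) in
      bobWins-mirror (mirror-assign mir (trans (+-comm (m ∸ l) l) eq))
        (reply v (m ∸ l) (mirror-legal (mirror-sym mir) eq legal))

-- Rooted trees

-- Edges point from parent to child. Since `m` edges have distinct children among `suc m` vertices,
-- exactly one vertex has no parent, and as heights fall towards parents, every vertex descends from
-- it.
record RootedTree (G : Graph) : Set where
  open Graph G
  field
    enumV         : Fin (suc m) ↔ V
    enumE         : Fin m ↔ E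
    height        : V → ℕ
    height-step   : ∀ e → height (proj₂ (ends e)) ≡ suc (height (proj₁ (ends e)))
    parent-unique : ∀ e e′ → proj₂ (ends e) ≡ proj₂ (ends e′) → e ≡ e′

module Tree {G : Graph} (T : RootedTree G) where
  open Graph G
  open RootedTree T
  open Position G

  Up : V → V → Set
  Up a b = ∃[ e ] ends e ≡ (a , b)

  orient : ∀ {a b} → Adj G a b → Up a b ⊎ Up b a
  orient (e , inj₁ p) = inj₁ (e , p)
  orient (e , inj₂ p) = inj₂ (e , p)

  up-height : ∀ {a b} → Up a b → height b ≡ suc (height a)
  up-height (e , refl) = height-step e

  up-< : ∀ {a b} → Up a b → height a < height b
  up-< p = ≤-reflexive (sym (up-height p))

  up-unique : ∀ {a b c} → Up a c → Up b c → a ≡ b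
  up-unique (e , p) (e′ , q) with parent-unique e e′ (trans (cong proj₂ p) (sym (cong proj₂ q)))
  ... | refl = ,-injectiveˡ (trans (sym p) q)

  joins-unique : ∀ {e e′ a b} → Joins e a b → Joins e′ a b → e ≡ e′
  joins-unique {e} {e′} (inj₁ p) (inj₁ q) = parent-unique e e′ (trans (cong proj₂ p) (sym (cong proj₂ q)))
  joins-unique {e} {e′} (inj₂ p) (inj₂ q) = parent-unique e e′ (trans (cong proj₂ p) (sym (cong proj₂ q)))
  joins-unique (inj₁ p) (inj₂ q) = contradiction (up-< (_ , q)) (ℕ.<-asym (up-< (_ , p)))
  joins-unique (inj₂ p) (inj₁ q) = contradiction (up-< (_ , q)) (ℕ.<-asym (up-< (_ , p)))

  loopless : ∀ {a} → ¬ Adj G a a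
  loopless p with orient p
  ... | inj₁ q = ℕ.<-irrefl refl (up-< q)
  ... | inj₂ q = ℕ.<-irrefl refl (up-< q)

  adj⇒≢ : ∀ {a b} → Adj G a b → a ≢ b
  adj⇒≢ p refl = loopless p

  -- Either some vertex is the child of two edges, so that two corners coincide, or the edges run in
  -- a cycle and heights increase all around it.
  triangle-free : ∀ {a b c} → Adj G a b → Adj G b c → ¬ Adj G a c
  triangle-free {a} {b} {c} p q r with orient p | orient q | orient r
  ... | inj₁ p | inj₁ q | inj₁ r = contradiction (up-unique q r) λ { refl → ℕ.<-irrefl refl (up-< p) }
  ... | inj₁ p | inj₁ q | inj₂ r = ℕ.<-asym (ℕ.<-trans (up-< p) (up-< q)) (up-< r)
  ... | inj₁ p | inj₂ q | _      = contradiction (up-unique p q) λ { refl → loopless r }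
  ... | inj₂ p | inj₁ q | inj₁ r = contradiction (up-unique q r) λ { refl → ℕ.<-irrefl refl (up-< p) }
  ... | inj₂ p | inj₁ q | inj₂ r = contradiction (up-unique p r) λ { refl → ℕ.<-irrefl refl (up-< q) }
  ... | inj₂ p | inj₂ q | inj₁ r = ℕ.<-asym (ℕ.<-trans (up-< q) (up-< p)) (up-< r)
  ... | inj₂ p | inj₂ q | inj₂ r = contradiction (up-unique p r) λ { refl → ℕ.<-irrefl refl (up-< q) }

  -- A common child of `a` and `c` would force `a ≡ c`, and two parents of the same vertex coincide.
  -- What remains is a directed cycle, against the heights.
  square-free : ∀ {a b c d} → a ≢ c → Adj G a b → Adj G b c → Adj G a d → Adj G d c → b ≡ d
  square-free a≢c ab bc ad dc with orient ab | orient bc | orient ad | orient dc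
  ... | inj₁ p | inj₂ q | _      | _      = contradiction (up-unique p q) a≢c
  ... | _      | _      | inj₁ p | inj₂ q = contradiction (up-unique p q) a≢c
  ... | inj₂ p | _      | inj₂ q | _      = up-unique p q
  ... | _      | inj₁ p | _      | inj₁ q = up-unique p q
  ... | inj₁ p | inj₁ q | inj₂ r | inj₂ s =
    contradiction (ℕ.<-trans (up-< s) (up-< r)) (ℕ.<-asym (ℕ.<-trans (up-< p) (up-< q)))
  ... | inj₂ p | inj₂ q | inj₁ r | inj₁ s =
    contradiction (ℕ.<-trans (up-< q) (up-< p)) (ℕ.<-asym (ℕ.<-trans (up-< r) (up-< s)))

  vertexAt : Fin (suc m) → V
  vertexAt = Inverse.to enumV

  vertexIndex : V → Fin (suc m)
  vertexIndex = Inverse.from enumV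

  vertexAt-index : ∀ a → vertexAt (vertexIndex a) ≡ a
  vertexAt-index = Inverse.strictlyInverseˡ enumV

  vertexIndex-injective : ∀ {a b} → vertexIndex a ≡ vertexIndex b → a ≡ b
  vertexIndex-injective {a} {b} eq = trans (sym (vertexAt-index a)) (trans (cong vertexAt eq) (vertexAt-index b))

  vertexAt-injective : ∀ {i j} → vertexAt i ≡ vertexAt j → i ≡ j
  vertexAt-injective {i} {j} eq = trans (sym (Inverse.strictlyInverseʳ enumV i))
    (trans (cong vertexIndex eq) (Inverse.strictlyInverseʳ enumV j))

  edgeAt : Fin m → E
  edgeAt = Inverse.to enumE

  edgeIndex : E → Fin m
  edgeIndex = Inverse.from enumE

  edgeAt-index : ∀ e → edgeAt (edgeIndex e) ≡ e
  edgeAt-index = Inverse.strictlyInverseˡ enumE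

  edgeAt-injective : ∀ {i j} → edgeAt i ≡ edgeAt j → i ≡ j
  edgeAt-injective {i} {j} eq = trans (sym (Inverse.strictlyInverseʳ enumE i))
    (trans (cong edgeIndex eq) (Inverse.strictlyInverseʳ enumE j))

  -- Decidable search for legal moves

  _≟E_ : (e e′ : E) → Dec (e ≡ e′)
  e ≟E e′ = map′ (λ eq → trans (sym (edgeAt-index e)) (trans (cong edgeAt eq) (edgeAt-index e′)))
                 (cong edgeIndex) (edgeIndex e Fin.≟ edgeIndex e′)

  anyV? : ∀ {P : V → Set} → (∀ a → Dec (P a)) → Dec (∃ P)
  anyV? {P} P? = map′ (λ (i , p) → vertexAt i , p)
    (λ (a , p) → vertexIndex a , subst P (sym (vertexAt-index a)) p) (any? (P? ∘ vertexAt))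

  allV? : ∀ {P : V → Set} → (∀ a → Dec (P a)) → Dec (∀ a → P a)
  allV? {P} P? = map′ (λ p a → subst P (vertexAt-index a) (p (vertexIndex a)))
    (λ p i → p (vertexAt i)) (all? (P? ∘ vertexAt))

  anyE? : ∀ {P : E → Set} → (∀ e → Dec (P e)) → Dec (∃ P)
  anyE? {P} P? = map′ (λ (i , p) → edgeAt i , p)
    (λ (a , p) → edgeIndex a , subst P (sym (edgeAt-index a)) p) (any? (P? ∘ edgeAt))

  allE? : ∀ {P : E → Set} → (∀ e → Dec (P e)) → Dec (∀ e → P e)
  allE? {P} P? = map′ (λ p a → subst P (edgeAt-index a) (p (edgeIndex a)))
    (λ p i → p (edgeAt i)) (all? (P? ∘ edgeAt))

  adj? : ∀ a b → Dec (Adj G a b)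
  adj? a b = anyE? λ e → (ends e ≟² (a , b)) ⊎-dec (ends e ≟² (b , a))
    where _≟²_ = Product.≡-dec _≟V_ _≟V_

  unique⇒length≤ : ∀ {xs} → Unique xs → length xs ≤ suc m
  unique⇒length≤ {xs} uniq = Fin.injective⇒≤ {f = vertexIndex ∘ lookup xs}
    (lookup-injective uniq ∘ vertexIndex-injective)
    where
    lookup-injective : ∀ {xs : List V} → Unique xs → ∀ {i j} → lookup xs i ≡ lookup xs j → i ≡ j
    lookup-injective (_ ∷ _)  {Fin.zero}  {Fin.zero}  _  = refl
    lookup-injective (x∉ ∷ _) {Fin.zero}  {Fin.suc j} eq = contradiction eq (All.lookup x∉ (∈-lookup j))
    lookup-injective (x∉ ∷ _) {Fin.suc i} {Fin.zero}  eq = contradiction (sym eq) (All.lookup x∉ (∈-lookup i))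
    lookup-injective (_ ∷ u)  {Fin.suc i} {Fin.suc j} eq = cong Fin.suc (lookup-injective u eq)

  cover⇒≤length : ∀ {xs} → (∀ a → a ∈ xs) → suc m ≤ length xs
  cover⇒≤length cov = Fin.injective⇒≤ {f = λ i → index (cov (vertexAt i))} λ {i} {j} eq →
    vertexAt-injective (index-injective (setoid V) (cov (vertexAt i)) (cov (vertexAt j)) eq)

  edgeLabel : Labeling G → E → Maybe ℕ
  edgeLabel f e = Data.Maybe.zipWith ∣_-_∣ (f (proj₁ (ends e))) (f (proj₂ (ends e)))

  edgeLabel-just : ∀ f e {a b x y} → ends e ≡ (a , b) → f a ≡ just x → f b ≡ just y →
                   edgeLabel f e ≡ just ∣ x - y ∣
  edgeLabel-just f e refl p q rewrite p | q = refl

  edgeLabel-inv : ∀ f e {k} → edgeLabel f e ≡ just k → ∃[ x ] ∃[ y ]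
                  f (proj₁ (ends e)) ≡ just x × f (proj₂ (ends e)) ≡ just y × ∣ x - y ∣ ≡ k
  edgeLabel-inv f e eq with f (proj₁ (ends e)) | f (proj₂ (ends e))
  ... | just x | just y = x , y , refl , refl , just-injective eq

  -- Edges that are not fully labelled all carry `nothing`; the first component keeps them from
  -- counting as equal.
  Clash : Labeling G → E → E → Set
  Clash f e e′ = edgeLabel f e ≢ nothing × edgeLabel f e ≡ edgeLabel f e′

  distinct? : ∀ f → Dec (EdgeLabelsDistinct G f)
  distinct? f = map′ to from
    (allE? λ e → allE? λ e′ → ¬? (e ≟E e′) →-dec ¬? (¬? (edgeLabel f e ≟M nothing) ×-dec (edgeLabel f e ≟M edgeLabel f e′)))
    where
    _≟M_ = Maybe.≡-dec ℕ._≟_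
    to : (∀ e e′ → e ≢ e′ → ¬ Clash f e e′) → EdgeLabelsDistinct G f
    to h e e′ e≢e′ p q x≡ y≡ x′≡ y′≡ eq = h e e′ e≢e′
      ( (λ none → contradiction (trans (sym none) (edgeLabel-just f e p x≡ y≡)) λ ())
      , trans (edgeLabel-just f e p x≡ y≡) (trans (cong just eq) (sym (edgeLabel-just f e′ q x′≡ y′≡))))
    from : EdgeLabelsDistinct G f → ∀ e e′ → e ≢ e′ → ¬ Clash f e e′
    from dist e e′ e≢e′ (some , same) with edgeLabel f e in eq
    ... | nothing = some refl
    ... | just k = let (_ , _ , p , q , r) = edgeLabel-inv f e eq
                       (_ , _ , p′ , q′ , r′) = edgeLabel-inv f e′ (sym same)
                   in dist e e′ e≢e′ refl refl p q p′ q′ (trans r (sym r′))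

  legal? : ∀ f v l → Dec (Legal G f v l)
  legal? f v l = Maybe.≡-dec ℕ._≟_ (f v) nothing ×-dec l ℕ.≤? m
    ×-dec allV? (λ a → ¬? (Maybe.≡-dec ℕ._≟_ (f a) (just l))) ×-dec distinct? (assign G f v l)

  anyLegal? : ∀ f → Dec (∃[ v ] ∃[ l ] Legal G f v l)
  anyLegal? f = anyV? λ v → map′
    (λ (i , legal) → toℕ i , legal)
    (λ (l , legal) → let l< = s≤s (proj₁ (proj₂ legal)) in
       fromℕ< l< , subst (Legal G f v) (sym (Fin.toℕ-fromℕ< l<)) legal)
    (any? {suc m} λ i → legal? f v (toℕ i))

  -- The fuel n bounds the number of free vertices: xs lists labelled ones.
  doomed⇒bobWins-fuel : ∀ n xs {f} → suc m ≤ n + length xs → Unique xs → (∀ {a} → a ∈ xs → f a ≢ nothing) →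
                        Valid f → Doomed f → ∀ p → BobWins G p f
  doomed⇒bobWins-fuel n xs {f} bound uniq taken val doom = wins
    where
    incomplete = doomed-incomplete val doom
    next : ∀ n → suc m ≤ n + length xs → ∀ v l → Legal G f v l → ∀ p → BobWins G p (assign G f v l)
    next n bound v l legal = step n bound
      where
      free = proj₁ legal
      taken′ : ∀ {a} → a ∈ v ∷ xs → assign G f v l a ≢ nothing
      taken′ a∈ eq with assign-free f v l eq | a∈
      ... | a≢v , _ | here a≡v = a≢v a≡v
      ... | _ , a-free | there a∈xs = taken a∈xs a-free
      uniq′ : Unique (v ∷ xs)
      uniq′ = All.tabulate (λ a∈ v≡a → taken a∈ (trans (cong f (sym v≡a)) free)) ∷ uniq
      step : ∀ n → suc m ≤ n + length xs → ∀ p → BobWins G p (assign G f v l)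
      -- Without fuel `xs` already lists `suc m` vertices, so `v` would be one too many.
      step zero bound = contradiction (≤-trans (unique⇒length≤ uniq′) bound) ℕ.1+n≰n
      step (suc n) bound = doomed⇒bobWins-fuel n (v ∷ xs) (≤-trans bound (≤-reflexive (sym (+-suc n (length xs)))))
        uniq′ taken′ (valid-assign val legal) (doomed-assign free doom)
    wins : ∀ p → BobWins G p f
    wins Alice = alice incomplete λ v l legal → next n bound v l legal Bob
    wins Bob with anyLegal? f
    ... | yes (v , l , legal) = bob-move v l legal (next n bound v l legal Alice)
    ... | no none = bob-stuck incomplete λ v l legal → none (v , l , legal)

  doomed⇒bobWins : ∀ {f} → Valid f → Doomed f → ∀ p → BobWins G p f
  doomed⇒bobWins = doomed⇒bobWins-fuel (suc m) [] (ℕ.m≤m+n (suc m) 0) [] λ ()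

-- Labels forced in a graceful labelling

∣-∣-maximal : ∀ {x y n} → x ≤ n → y ≤ n → ∣ x - y ∣ ≡ n → (x ≡ 0 × y ≡ n) ⊎ (y ≡ 0 × x ≡ n)
∣-∣-maximal {x} {y} x≤n y≤n eq =
  Data.Sum.map (sharp y≤n) (sharp x≤n)
    (subst (λ k → (y ≡ x + k) ⊎ (x ≡ y + k)) eq (∣-∣-cases x y))
  where
  sharp : ∀ {x y n} → y ≤ n → y ≡ x + n → x ≡ 0 × y ≡ n
  sharp {x} {y} {n} y≤n y≡ with refl ← ℕ.n≤0⇒n≡0 {x} (ℕ.+-cancelʳ-≤ n x 0 (subst (_≤ n) y≡ y≤n)) = refl , y≡

-- With `m` as `suc n`, this locates the edge labelled `m - 1`: its smaller end carries `0` or `1`.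
∣-∣-submaximal : ∀ {x y n} → x ≤ suc n → y ≤ suc n → ∣ x - y ∣ ≡ n →
                 ((x ≡ 0 × y ≡ n) ⊎ (x ≡ 1 × y ≡ suc n)) ⊎ ((y ≡ 0 × x ≡ n) ⊎ (y ≡ 1 × x ≡ suc n))
∣-∣-submaximal {x} {y} x≤ y≤ eq =
  Data.Sum.map (sharp y≤) (sharp x≤)
    (subst (λ k → (y ≡ x + k) ⊎ (x ≡ y + k)) eq (∣-∣-cases x y))
  where
  sharp : ∀ {x y n} → y ≤ suc n → y ≡ x + n → (x ≡ 0 × y ≡ n) ⊎ (x ≡ 1 × y ≡ suc n)
  sharp {x} {y} {n} y≤ y≡ with x | ℕ.+-cancelʳ-≤ n x 1 (subst (_≤ suc n) y≡ y≤) | y≡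
  ... | 0 | _ | eq = inj₁ (refl , eq)
  ... | 1 | _ | eq = inj₂ (refl , eq)
  ... | suc (suc _) | s≤s () | _

2≤⇒suc : ∀ {k} → 2 ≤ k → ∃[ n ] k ≡ suc n × 1 ≤ n
2≤⇒suc (s≤s 1≤n) = _ , refl , 1≤n

module Labelled {G : Graph} (T : RootedTree G) where
  open Graph G
  open Position G
  open Tree T

  record Leaf (v u : V) : Set where
    field
      stem      : Adj G v u
      only-stem : ∀ {a} → Adj G v a → a ≡ u

  adj⇒0<m : ∀ {a b} → Adj G a b → 0 < m
  adj⇒0<m (e , _) with m | edgeIndex e
  ... | suc _ | _ = s≤s z≤n

  module _ {g : V → ℕ} (gr : Graceful g) where
    open Graceful gr

    value : E → ℕ
    value e = ∣ g (proj₁ (ends e)) - g (proj₂ (ends e)) ∣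

    value-joins : ∀ {e a b} → Joins e a b → value e ≡ ∣ g a - g b ∣
    value-joins (inj₁ p) rewrite p = refl
    value-joins {a = a} {b} (inj₂ p) rewrite p = ℕ.∣-∣-comm (g b) (g a)

    value-injective : ∀ {e e′} → value e ≡ value e′ → e ≡ e′
    value-injective {e} {e′} eq = decidable-stable (e ≟E e′) λ e≢e′ →
      distinct e e′ e≢e′ refl refl refl refl refl refl eq

    value-positive : ∀ e → value e ≡ suc (pred (value e))
    value-positive e with value e in eq
    ... | suc _ = refl
    ... | zero = contradiction (e , inj₁ refl)
                   (λ adj → adj⇒≢ adj (injective (ℕ.∣m-n∣≡0⇒m≡n {g (proj₁ (ends e))} eq)))

    clash-free : ∀ {a b c d} → Adj G a b → Adj G c d → ∣ g a - g b ∣ ≡ ∣ g c - g d ∣ →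
                 (a ≡ c × b ≡ d) ⊎ (a ≡ d × b ≡ c)
    clash-free (e , p) (e′ , q) eq
      with value-injective {e} {e′} (trans (value-joins p) (trans eq (sym (value-joins q)))) | p | q
    ... | refl | inj₁ p | inj₁ q = let r = trans (sym p) q in inj₁ (,-injectiveˡ r , ,-injectiveʳ r)
    ... | refl | inj₂ p | inj₂ q = let r = trans (sym p) q in inj₁ (,-injectiveʳ r , ,-injectiveˡ r)
    ... | refl | inj₁ p | inj₂ q = let r = trans (sym p) q in inj₂ (,-injectiveˡ r , ,-injectiveʳ r)
    ... | refl | inj₂ p | inj₁ q = let r = trans (sym p) q in inj₂ (,-injectiveʳ r , ,-injectiveˡ r)

    onto : ∀ {l} → l ≤ m → ∃[ a ] g a ≡ l
    onto l≤m = let (i , eq) = injective⇒onto (g ∘ vertexAt) (s≤s ∘ bounded ∘ vertexAt)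
                                (vertexAt-injective ∘ injective) (s≤s l≤m)
               in vertexAt i , eq

    -- The `m` edge labels are distinct and positive, since label `0` would need a loop. Lowering
    -- them by one brings them into the range of the pigeonhole lemma.
    edge-onto : ∀ {k} → 1 ≤ k → k ≤ m → ∃[ a ] ∃[ b ] Adj G a b × ∣ g a - g b ∣ ≡ k
    edge-onto {suc k} _ k<m =
      let (i , eq) = injective⇒onto (pred ∘ value ∘ edgeAt) below inj k<m
          e = edgeAt i
      in _ , _ , (e , inj₁ refl) , trans (value-positive e) (cong suc eq)
      where
      below : ∀ i → pred (value (edgeAt i)) < m
      below i = subst (_≤ m) (value-positive (edgeAt i)) (∣-∣-mono-≤ (bounded _) (bounded _))
      inj : ∀ {i j} → pred (value (edgeAt i)) ≡ pred (value (edgeAt j)) → i ≡ j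
      inj {i} {j} eq = edgeAt-injective (value-injective
        (trans (value-positive _) (trans (cong suc eq) (sym (value-positive _)))))

    extremes-adj : 0 < m → ∀ {a b} → g a ≡ 0 → g b ≡ m → Adj G a b
    extremes-adj 0<m ga gb with edge-onto 0<m ≤-refl
    ... | c , d , adj , eq with ∣-∣-maximal (bounded c) (bounded d) eq
    ...   | inj₁ (gc , gd) = subst₂ (Adj G) (injective (trans gc (sym ga))) (injective (trans gd (sym gb))) adj
    ...   | inj₂ (gd , gc) = subst₂ (Adj G) (injective (trans gd (sym ga))) (injective (trans gc (sym gb))) (Adj-sym adj)

    leaf-0⇒stem-m : ∀ {v u} → Leaf v u → g v ≡ 0 → g u ≡ m
    leaf-0⇒stem-m lf gv = let (b , gb) = onto ≤-refl in
      subst (λ a → g a ≡ m) (Leaf.only-stem lf (extremes-adj (adj⇒0<m (Leaf.stem lf)) gv gb)) gb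

    -- The edge labelled `m - 1` has ends `0, m - 1` or `1, m`. The first pair would put `m - 1` on
    -- `u`, the only neighbour of the `0`, but `u` carries `m`.
    leaf-0⇒1-adj : 2 ≤ m → ∀ {v u x} → Leaf v u → g v ≡ 0 → g x ≡ 1 → Adj G x u
    leaf-0⇒1-adj 2≤m {v} {u} {x} lf gv gx with 2≤⇒suc 2≤m
    ... | n , m≡ , 1≤n with edge-onto 1≤n (subst (n ≤_) (sym m≡) (ℕ.n≤1+n n))
    ...   | c , d , adj , eq =
      [ locate adj , locate (Adj-sym adj) ]
        (∣-∣-submaximal (subst (g c ≤_) m≡ (bounded c)) (subst (g d ≤_) m≡ (bounded d)) eq)
      where
      gu≡m = leaf-0⇒stem-m lf gv
      locate : ∀ {c d} → Adj G c d → (g c ≡ 0 × g d ≡ n) ⊎ (g c ≡ 1 × g d ≡ suc n) → Adj G x u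
      locate cd (inj₁ (gc , gd)) with refl ← injective (trans gc (sym gv)) with refl ← Leaf.only-stem lf cd =
        contradiction (trans (sym gd) (trans gu≡m m≡)) (ℕ.<⇒≢ ≤-refl)
      locate cd (inj₂ (gc , gd)) =
        subst₂ (Adj G) (injective (trans gc (sym gx))) (injective (trans gd (trans (sym m≡) (sym gu≡m)))) cd

  -- Old edges differ from each other by validity. A clash therefore involves a new edge at `v`,
  -- paired with another new edge or with an old one; the last two hypotheses exclude these.
  extend-legal : ∀ {f v l} → Valid f → f v ≡ nothing → l ≤ m → (∀ a → f a ≢ just l) →
    (∀ {a b x y} → Adj G v a → f a ≡ just x → Adj G v b → f b ≡ just y → ∣ x - l ∣ ≡ ∣ y - l ∣ → a ≡ b) →
    (∀ {a b c x y z} → Adj G v a → f a ≡ just x → Adj G b c → f b ≡ just y → f c ≡ just z → ∣ x - l ∣ ≢ ∣ y - z ∣) →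
    Legal G f v l
  extend-legal {f} {v} {l} val free l≤m fresh new-new new-old = free , l≤m , fresh , dist
    where
    New : E → ℕ → Set
    New e k = ∃[ c ] ∃[ x ] Joins e v c × f c ≡ just x × k ≡ ∣ x - l ∣
    split : ∀ e {a b x y} → ends e ≡ (a , b) → assign G f v l a ≡ just x → assign G f v l b ≡ just y →
            New e ∣ x - y ∣ ⊎ (f a ≡ just x × f b ≡ just y)
    split e {x = x} {y} p ax by with assign-inv f v l ax | assign-inv f v l by
    ... | inj₁ (refl , _)    | inj₁ (refl , _)    = contradiction (e , inj₁ p) loopless
    ... | inj₁ (refl , refl) | inj₂ (_ , q)       = inj₁ (_ , y , inj₁ p , q , ℕ.∣-∣-comm l y)
    ... | inj₂ (_ , q)       | inj₁ (refl , refl) = inj₁ (_ , x , inj₂ p , q , refl)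
    ... | inj₂ (_ , q)       | inj₂ (_ , r)       = inj₂ (q , r)
    dist : EdgeLabelsDistinct G (assign G f v l)
    dist e e′ e≢e′ p q ax by ax′ by′ eq with split e p ax by | split e′ q ax′ by′
    ... | inj₁ (_ , _ , j , s , k) | inj₁ (_ , _ , j′ , s′ , k′)
      with new-new (e , j) s (e′ , j′) s′ (trans (sym k) (trans eq k′))
    ...   | refl = e≢e′ (joins-unique j j′)
    dist e e′ e≢e′ p q ax by ax′ by′ eq | inj₁ (_ , _ , j , s , k) | inj₂ (s₁ , s₂) =
      new-old (e , j) s (e′ , inj₁ q) s₁ s₂ (trans (sym k) eq)
    dist e e′ e≢e′ p q ax by ax′ by′ eq | inj₂ (s₁ , s₂) | inj₁ (_ , _ , j , s , k) =
      new-old (e′ , j) s (e , inj₁ p) s₁ s₂ (trans (sym k) (sym eq))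
    dist e e′ e≢e′ p q ax by ax′ by′ eq | inj₂ (s₁ , s₂) | inj₂ (s₃ , s₄) =
      Valid.distinct val e e′ e≢e′ p q s₁ s₂ s₃ s₄ eq

-- Bob's first move and the simple openings of Alice

-- Two points equidistant from `a` coincide or have `a` as midpoint. The midpoint equation is the
-- source of conditions such as `l + l ≡ m + k` below.
∣a-b∣≡∣a-c∣⇒ : ∀ a b c → ∣ a - b ∣ ≡ ∣ a - c ∣ → b ≡ c ⊎ a + a ≡ b + c
∣a-b∣≡∣a-c∣⇒ a b c eq with ∣-∣-cases a b | ∣-∣-cases a c
... | inj₁ p | inj₁ q = inj₁ (trans p (trans (cong (a +_) eq) (sym q)))
... | inj₂ p | inj₂ q = inj₁ (ℕ.+-cancelʳ-≡ _ b c (trans (sym p) (trans q (cong (c +_) (sym eq)))))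
... | inj₁ p | inj₂ q = inj₂ (trans (cong (a +_) (trans q (trans (cong (c +_) (sym eq)) (+-comm c _))))
                              (trans (sym (+-assoc a _ c)) (cong (_+ c) (sym p))))
... | inj₂ p | inj₁ q = inj₂ (trans (cong (_+ a) p) (trans (+-assoc b _ a)
                              (cong (b +_) (trans (+-comm _ a) (trans (cong (a +_) eq) (sym q))))))

∣k-1∣<n : ∀ {k n} → 1 ≤ k → k < n → ∣ k - 1 ∣ < n
∣k-1∣<n {suc k} _ k<n rewrite ℕ.∣-∣-identityʳ k = ℕ.<-trans ≤-refl k<n

module Strategy {G : Graph} (T : RootedTree G) where
  open Graph G
  open Position G
  open Tree T
  open Labelled T

  -- Only an upper bound on the labelled vertices, which is enough to enumerate labelled neighbours
  -- by matching on membership.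
  On : Labeling G → List (V × ℕ) → Set
  On f ps = ∀ {a x} → f a ≡ just x → (a , x) ∈ ps

  on-empty : On (empty G) []
  on-empty ()

  on-assign : ∀ {f ps} v l → On f ps → On (assign G f v l) ((v , l) ∷ ps)
  on-assign {f} v l on p with assign-inv f v l p
  ... | inj₁ (refl , refl) = here refl
  ... | inj₂ (_ , q) = there (on q)

  on-free : ∀ {f ps a} → On f ps → a ∉ Data.List.map proj₁ ps → f a ≡ nothing
  on-free {f} {ps} {a} on a∉ with f a in eq
  ... | nothing = refl
  ... | just x = contradiction (∈-map⁺ proj₁ (on eq)) a∉

  on-fresh : ∀ {f ps l} → On f ps → l ∉ Data.List.map proj₂ ps → ∀ a → f a ≢ just l
  on-fresh on l∉ a eq = l∉ (∈-map⁺ proj₂ (on eq))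

  wins-by-dooming : ∀ {f v l} → Valid f → Legal G f v l → Doomed (assign G f v l) → BobWins G Bob f
  wins-by-dooming val legal doom = bob-move _ _ legal (doomed⇒bobWins (valid-assign val legal) doom Alice)

  first-legal : ∀ {w l} → l ≤ m → Legal G (empty G) w l
  first-legal l≤m = extend-legal valid-empty refl l≤m (λ _ ()) (λ _ ()) (λ _ ())

  first-valid : ∀ {w l} → l ≤ m → Valid (assign G (empty G) w l)
  first-valid l≤m = valid-assign valid-empty (first-legal l≤m)

  -- With a single labelled vertex there is no old edge and at most one new edge, so nothing can
  -- clash.
  second-legal : ∀ {w l a k} → l ≤ m → k ≤ m → a ≢ w → k ≢ l → Legal G (assign G (empty G) w l) a k
  second-legal {w} {l} {a} {k} l≤m k≤m a≢w k≢l = extend-legal (first-valid l≤m)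
    (assign-other (empty G) l a≢w) k≤m (on-fresh on λ { (here k≡l) → k≢l k≡l })
    (λ _ p _ q _ → same (on p) (on q))
    (λ _ _ bc p q → contradiction bc (λ adj → adj⇒≢ adj (same (on p) (on q))))
    where
    on : On (assign G (empty G) w l) ((w , l) ∷ [])
    on = on-assign w l on-empty
    same : ∀ {b c x y} → (b , x) ∈ (w , l) ∷ [] → (c , y) ∈ (w , l) ∷ [] → b ≡ c
    same (here refl) (here refl) = refl

  extends₂ : ∀ {g w l a k} → a ≢ w → Extends g (assign G (assign G (empty G) w l) a k) → g a ≡ k × g w ≡ l
  extends₂ {w = w} {l} a≢w ext =
    let (ga , ext₁) = extends-assign (assign-other (empty G) l a≢w) ext
    in ga , proj₁ (extends-assign {empty G} {w} refl ext₁)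

  -- Two disjoint pendant edges `v u` and `v′ u′`: the form in which the strategy uses that the
  -- diameter is at least three.
  record Fork (v u v′ u′ : V) : Set where
    field
      leaf    : Leaf v u
      leaf′   : Leaf v′ u′
      u≢u′    : u ≢ u′
      v≢u′    : v ≢ u′
      v′≢u    : v′ ≢ u

    open Leaf leaf public
    open Leaf leaf′ public renaming (stem to stem′; only-stem to only-stem′)

    v≢u : v ≢ u
    v≢u = adj⇒≢ stem

    v′≢u′ : v′ ≢ u′
    v′≢u′ = adj⇒≢ stem′

    v≢v′ : v ≢ v′
    v≢v′ refl = u≢u′ (only-stem′ stem)

    3≤m : 3 ≤ m
    3≤m = ℕ.≤-pred (unique⇒length≤
      ((v≢u ∷ v≢v′ ∷ v≢u′ ∷ []) ∷ ((λ p → v′≢u (sym p)) ∷ u≢u′ ∷ []) ∷ (v′≢u′ ∷ []) ∷ [] ∷ []))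

    2≤m : 2 ≤ m
    2≤m = ≤-trans (s≤s (s≤s z≤n)) 3≤m

    0≢m : 0 ≢ m
    0≢m = ℕ.<⇒≢ (≤-trans (s≤s z≤n) 3≤m)

    1≢m : 1 ≢ m
    1≢m = ℕ.<⇒≢ (≤-trans (s≤s (s≤s z≤n)) 3≤m)

    -- Supplies the vertex for Bob's `m` after an opening with `0` at `w`. The leaf `v` qualifies
    -- unless `w` is `v` or `u`, and then `v′` does.
    far : ∀ w → ∃[ x ] x ≢ w × ¬ Adj G w x
    far w with w ≟V v | w ≟V u
    ... | yes refl | _ = v′ , (λ p → v≢v′ (sym p)) , λ adj → v′≢u (only-stem adj)
    ... | no _ | yes refl = v′ , v′≢u , λ adj → u≢u′ (only-stem′ (Adj-sym adj))
    ... | no w≢v | no w≢u = v , (λ p → w≢v (sym p)) , λ adj → w≢u (only-stem (Adj-sym adj))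

  fork-swap : ∀ {v u v′ u′} → Fork v u v′ u′ → Fork v′ u′ v u
  fork-swap fk = record
    { leaf = leaf′ ; leaf′ = leaf ; u≢u′ = λ p → u≢u′ (sym p) ; v≢u′ = v′≢u ; v′≢u = v≢u′ }
    where open Fork fk

  -- A graceful labelling has `0` and `m` on adjacent vertices, so Bob spoils it by `m` on a vertex
  -- not adjacent to `w`.
  opening-0 : ∀ {v u v′ u′} → Fork v u v′ u′ → ∀ w → BobWins G Bob (assign G (empty G) w 0)
  opening-0 fk w = let (x , x≢w , w≁x) = far w in
    wins-by-dooming (first-valid z≤n) (second-legal z≤n ≤-refl x≢w (λ p → 0≢m (sym p)))
      λ gr ext → let (gx , gw) = extends₂ x≢w ext in w≁x (extremes-adj gr (adj⇒0<m stem) gw gx)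
    where open Fork fk

  -- Bob's `0` at the leaf demands `m` at `u`, where another label already stands.
  opening-stem : ∀ {v u l} → Leaf v u → l ≤ m → l ≢ 0 → l ≢ m → BobWins G Bob (assign G (empty G) u l)
  opening-stem {v} {u} lf l≤m l≢0 l≢m =
    wins-by-dooming (first-valid l≤m) (second-legal l≤m z≤n v≢u (λ p → l≢0 (sym p)))
      λ gr ext → let (gv , gu) = extends₂ v≢u ext in l≢m (trans (sym gu) (leaf-0⇒stem-m gr lf gv))
    where v≢u = adj⇒≢ (Leaf.stem lf)

  -- Bob's `0` at `v` demands that `1` be next to `u`, but it stands at `w`.
  opening-1 : ∀ {v u v′ u′} → Fork v u v′ u′ → ∀ {w} → w ≢ v → ¬ Adj G w u →
              BobWins G Bob (assign G (empty G) w 1)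
  opening-1 fk w≢v w≁u =
    wins-by-dooming (first-valid 1≤m) (second-legal 1≤m z≤n (λ p → w≢v (sym p)) λ ())
      λ gr ext → let (gv , gw) = extends₂ (λ p → w≢v (sym p)) ext in w≁u (leaf-0⇒1-adj gr 2≤m leaf gv gw)
    where
    open Fork fk
    1≤m = adj⇒0<m stem

  -- Bob opens with `0` at `v`. Putting `m` off `u`, or another label on `u`, dooms the position at
  -- once. To `m` at `u` Bob replies `1` at `v′`, and to anything else `m` away from `u`.
  bob-first : ∀ {v u v′ u′} → Fork v u v′ u′ → BobWins G Bob (empty G)
  bob-first {v} {u} {v′} {u′} fk = bob-move v 0 (first-legal z≤n) (alice incomplete reply)
    where
    open Fork fk
    f₁ = assign G (empty G) v 0
    val₁ : Valid f₁
    val₁ = first-valid z≤n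
    incomplete : ¬ Complete G f₁
    incomplete total with trans (sym (assign-other (empty G) 0 (λ p → v≢u (sym p)))) (proj₂ (total u))
    ... | ()
    reply : ∀ z l → Legal G f₁ z l → BobWins G Bob (assign G f₁ z l)
    reply z l legal = cases (z ≟V u) (l ℕ.≟ m)
      where
      val₂ = valid-assign val₁ legal
      z≢v = proj₁ (assign-free (empty G) v 0 (proj₁ legal))
      on : On (assign G f₁ z l) ((z , l) ∷ (v , 0) ∷ [])
      on = on-assign z l (on-assign v 0 on-empty)
      l≢0 : l ≢ 0
      l≢0 refl = proj₁ (proj₂ (proj₂ legal)) v (assign-same (empty G) v 0)
      values : ∀ {g x k} → x ∉ z ∷ v ∷ [] → Extends g (assign G (assign G f₁ z l) x k) → g x ≡ k × g v ≡ 0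
      values x∉ ext = let (gx , ext₂) = extends-assign (on-free on x∉) ext in
        gx , proj₂ (extends₂ z≢v ext₂)
      max-at : ∀ {x} → z ≢ u → l ≢ m → x ≢ z → x ≢ v → x ≢ u → BobWins G Bob (assign G f₁ z l)
      max-at {x} z≢u l≢m x≢z x≢v x≢u = wins-by-dooming val₂
        (extend-legal val₂ (on-free on x∉) ≤-refl
          (on-fresh on λ { (here p) → l≢m (sym p) ; (there (here p)) → 0≢m (sym p) })
          (λ _ p _ q eq → Valid.injective val₂ p (trans q (cong just
             (sym (∣x-n∣-injective (Valid.bounded val₂ p) (Valid.bounded val₂ q) eq)))))
          (λ _ _ bc p q → contradiction bc (no-edge (on p) (on q))))
        λ gr ext → let (gx , gv) = values x∉ ext in
          x≢u (Graceful.injective gr (trans gx (sym (leaf-0⇒stem-m gr leaf gv))))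
        where
        x∉ : x ∉ z ∷ v ∷ []
        x∉ (here p) = x≢z p
        x∉ (there (here p)) = x≢v p
        -- No edge is labelled before the move: the only neighbour of `v` is `u`, which is still
        -- free.
        no-edge : ∀ {b c y y′} → (b , y) ∈ (z , l) ∷ (v , 0) ∷ [] → (c , y′) ∈ (z , l) ∷ (v , 0) ∷ [] → ¬ Adj G b c
        no-edge (here refl) (here refl) adj = loopless adj
        no-edge (here refl) (there (here refl)) adj = z≢u (only-stem (Adj-sym adj))
        no-edge (there (here refl)) (here refl) adj = z≢u (only-stem adj)
        no-edge (there (here refl)) (there (here refl)) adj = loopless adj
      cases : Dec (z ≡ u) → Dec (l ≡ m) → BobWins G Bob (assign G f₁ z l)
      cases (yes refl) (yes refl) = wins-by-dooming val₂
        (extend-legal val₂ (on-free on v′∉) (≤-trans (s≤s z≤n) 3≤m)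
          (on-fresh on λ { (here p) → 1≢m p ; (there (here ())) })
          (λ adj p → contradiction adj (v′-isolated (on p)))
          (λ adj p → contradiction adj (v′-isolated (on p))))
        λ gr ext → let (gv′ , gv) = values v′∉ ext in
          u≢u′ (only-stem′ (leaf-0⇒1-adj gr 2≤m leaf gv gv′))
        where
        v′∉ : v′ ∉ u ∷ v ∷ []
        v′∉ (here p) = v′≢u p
        v′∉ (there (here p)) = v≢v′ (sym p)
        v′-isolated : ∀ {a y} → (a , y) ∈ (u , m) ∷ (v , 0) ∷ [] → ¬ Adj G v′ a
        v′-isolated (here refl) adj = u≢u′ (only-stem′ adj)
        v′-isolated (there (here refl)) adj = v≢u′ (only-stem′ adj)
      cases (yes refl) (no l≢m) = doomed⇒bobWins val₂
        (λ gr ext → let (gu , gv) = extends₂ z≢v ext in l≢m (trans (sym gu) (leaf-0⇒stem-m gr leaf gv))) Bob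
      cases (no z≢u) (yes refl) = doomed⇒bobWins val₂
        (λ gr ext → let (gz , gv) = extends₂ z≢v ext in
          z≢u (Graceful.injective gr (trans gz (sym (leaf-0⇒stem-m gr leaf gv))))) Bob
      -- Bob's `m` goes on `v′`, or on `u′` if Alice has just taken `v′`.
      cases (no z≢u) (no l≢m) with z ≟V v′
      ... | yes refl = max-at z≢u l≢m (λ p → v′≢u′ (sym p)) (λ p → v≢u′ (sym p)) (λ p → u≢u′ (sym p))
      ... | no z≢v′ = max-at z≢u l≢m (λ p → z≢v′ (sym p)) (λ p → v≢v′ (sym p)) v′≢u

-- Exceptional positions: the five-vertex path and the hub

module AliceOpens {G : Graph} (T : RootedTree G) where
  open Graph G
  open Position G
  open Tree T
  open Labelled T
  open Strategy T

  -- On the path v u x u′ v′ Alice can answer 0 at v by 3 at u′, so Bob plays 0 at u′ instead.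
  opening-path : ∀ {v u v′ u′} → Fork v u v′ u′ → m ≡ 4 → ¬ Adj G u u′ →
                 BobWins G Bob (assign G (empty G) v′ 2)
  opening-path {v} {u} {v′} {u′} fk m≡4 u≁u′ with anyV? (λ a → ¬? (a ∈? (v ∷ u ∷ v′ ∷ u′ ∷ [])))
  ... | no none = contradiction
          (subst (_≤ 3) m≡4 (ℕ.≤-pred (cover⇒≤length (λ a → decidable-stable (a ∈? _) λ a∉ → none (a , a∉)))))
          ℕ.1+n≰n
  ... | yes (x , x∉) =
    wins-by-dooming (first-valid 2≤m) (second-legal 2≤m z≤n (λ p → v′≢u′ (sym p)) λ ()) λ gr ext →
      let (gu′ , gv′) = extends₂ (λ p → v′≢u′ (sym p)) ext in doom gr gu′ gv′
    where
    open Fork fk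
    path = v ∷ u ∷ v′ ∷ u′ ∷ x ∷ []
    x≢v : x ≢ v
    x≢v p = x∉ (here p)
    x≢u : x ≢ u
    x≢u p = x∉ (there (here p))
    x≢v′ : x ≢ v′
    x≢v′ p = x∉ (there (there (here p)))
    x≢u′ : x ≢ u′
    x≢u′ p = x∉ (there (there (there (here p))))
    cover : ∀ a → a ∈ path
    cover a with a ∈? path
    ... | yes a∈ = a∈
    ... | no a∉ = contradiction
      (subst (5 ≤_) m≡4 (ℕ.≤-pred (unique⇒length≤
        ( ((λ p → a∉ (here p)) ∷ (λ p → a∉ (there (here p))) ∷ (λ p → a∉ (there (there (here p)))) ∷ (λ p → a∉ (there (there (there (here p))))) ∷ (λ p → a∉ (there (there (there (there (here p)))))) ∷ [])
        ∷ (v≢u ∷ v≢v′ ∷ v≢u′ ∷ (λ p → x≢v (sym p)) ∷ [])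
        ∷ ((λ p → v′≢u (sym p)) ∷ u≢u′ ∷ (λ p → x≢u (sym p)) ∷ [])
        ∷ (v′≢u′ ∷ (λ p → x≢v′ (sym p)) ∷ [])
        ∷ ((λ p → x≢u′ (sym p)) ∷ [])
        ∷ [] ∷ []))))
      ℕ.1+n≰n
    v≁u′ : ¬ Adj G v u′
    v≁u′ adj = u≢u′ (sym (only-stem adj))
    -- The labels `4`, `1`, `3` are forced on `x`, `u`, `v` in this order: `4` next to the `0`, then
    -- `1` next to the `4` for the edge label `3`, then what is left. Now `v u` and `v′ u′` both
    -- have edge label `2`.
    module _ {g} (gr : Graceful g) (gu′ : g u′ ≡ 0) (gv′ : g v′ ≡ 2) where
      open Graceful gr
      agree : ∀ {a k l} → g a ≡ k → g a ≡ l → k ≡ l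
      agree p q = trans (sym p) q
      neighbour : ∀ {a k} → Adj G u′ a → g a ≡ k → k ≢ 2 → a ≡ x
      neighbour {a} adj ga k≢2 with cover a
      ... | here refl = contradiction (Adj-sym adj) v≁u′
      ... | there (here refl) = contradiction (Adj-sym adj) u≁u′
      ... | there (there (here refl)) = contradiction (agree ga gv′) k≢2
      ... | there (there (there (here refl))) = contradiction adj loopless
      ... | there (there (there (there (here refl)))) = refl
      gx : g x ≡ 4
      gx = let (a , ga) = onto gr ≤-refl in
        trans (cong g (sym (neighbour (extremes-adj gr (adj⇒0<m stem) gu′ ga) (trans ga m≡4) λ ()))) (trans ga m≡4)
      gu : g u ≡ 1
      gu with edge-onto gr {3} (s≤s z≤n) 3≤m
      ... | c , d , adj , eq =
        [ locate adj , locate (Adj-sym adj) ]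
          (∣-∣-submaximal (subst (g c ≤_) m≡4 (bounded c)) (subst (g d ≤_) m≡4 (bounded d)) eq)
        where
        locate : ∀ {c d} → Adj G c d → (g c ≡ 0 × g d ≡ 3) ⊎ (g c ≡ 1 × g d ≡ 4) → g u ≡ 1
        locate cd (inj₁ (gc , gd)) with refl ← injective (trans gc (sym gu′)) =
          contradiction (agree (trans (cong g (sym (neighbour cd gd λ ()))) gd) gx) λ ()
        locate {c} {d} cd (inj₂ (gc , gd)) with refl ← injective (trans gd (sym gx)) with cover c
        ... | here refl = contradiction (only-stem cd) x≢u
        ... | there (here refl) = gc
        ... | there (there (here refl)) = contradiction (agree gc gv′) λ ()
        ... | there (there (there (here refl))) = contradiction (agree gc gu′) λ ()
        ... | there (there (there (there (here refl)))) = contradiction (agree gc gx) λ ()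
      gv : g v ≡ 3
      gv with onto gr 3≤m
      ... | a , ga with cover a
      ...   | here refl = ga
      ...   | there (here refl) = contradiction (agree ga gu) λ ()
      ...   | there (there (here refl)) = contradiction (agree ga gv′) λ ()
      ...   | there (there (there (here refl))) = contradiction (agree ga gu′) λ ()
      ...   | there (there (there (there (here refl)))) = contradiction (agree ga gx) λ ()
      doom : ⊥
      doom with clash-free gr stem stem′ (trans (cong₂ ∣_-_∣ gv gu) (sym (cong₂ ∣_-_∣ gv′ gu′)))
      ... | inj₁ (v≡v′ , _) = v≢v′ v≡v′
      ... | inj₂ (v≡u′ , _) = v≢u′ v≡u′

  -- The hub h obstructs m at every free vertex except u; then 1 away from u is playable,
  -- unless the tree is the path v u x h o.
  hub : ∀ {v u v′ u′} → Fork v u v′ u′ → ∀ {f h k o j} → Valid f →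
        f h ≡ just k → f v ≡ just 0 → f o ≡ just j → On f ((h , k) ∷ (v , 0) ∷ (o , j) ∷ []) →
        Adj G h o → k + k ≡ m + j → j ≢ 1 → h ≢ u → o ≢ u →
        ∃[ x ] x ∉ u ∷ v ∷ h ∷ o ∷ [] →
        (∀ {x} → x ∉ u ∷ v ∷ h ∷ o ∷ [] → Adj G x h) →
        (o ≡ v′ → h ≡ u′ → ¬ Adj G u h → m ≤ 4 → ⊥) →
        BobWins G Bob f
  hub {v} {u} {v′} {u′} fk {f} {h} {k} {o} {j} val fh fv fo on ho 2k≡ j≢1 h≢u o≢u (x , x∉) all-h not-path
    with adj? h u
  -- The forced `m` at `u` would give `h u` the edge label of `h o`, because `k` is the midpoint of
  -- `m` and `j`.
  ... | yes hu = doomed⇒bobWins val conflict Bob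
    where
    open Fork fk
    conflict : Doomed f
    conflict {g} gr ext with clash-free gr hu ho
      (trans (cong₂ ∣_-_∣ (ext fh) (leaf-0⇒stem-m gr leaf (ext fv)))
        (trans (∣-∣-reflect k m {k} {j} 2k≡ refl) (sym (cong₂ ∣_-_∣ (ext fh) (ext fo)))))
    ... | inj₁ (_ , u≡o) = o≢u (sym u≡o)
    ... | inj₂ (_ , u≡h) = h≢u (sym u≡h)
  ... | no h≁u with anyV? (λ a → ¬? (a ∈? (u ∷ v ∷ h ∷ o ∷ [])) ×-dec ¬? (adj? a u))
  ...   | yes (a , a∉ , a≁u) = wins-by-dooming val
          (extend-legal val free (≤-trans (s≤s z≤n) 3≤m)
            (on-fresh on λ { (here 1≡k) → 1≢k 1≡k ; (there (here ())) ; (there (there (here 1≡j))) → j≢1 (sym 1≡j) })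
            (λ ab p ac q _ → trans (proj₁ (only-h ab (on p))) (sym (proj₁ (only-h ac (on q)))))
            λ ab p bc q r eq → new-old (trans (cong ∣_- 1 ∣ (sym (proj₂ (only-h ab (on p))))) (trans eq (old bc (on q) (on r)))))
          λ gr ext → let (ga , ext′) = extends-assign free ext in
            a≁u (leaf-0⇒1-adj gr 2≤m leaf (ext′ fv) ga)
    where
    open Fork fk
    free : f a ≡ nothing
    free = on-free on λ { (here p) → a∉ (there (there (here p))) ; (there (here p)) → a∉ (there (here p))
                        ; (there (there (here p))) → a∉ (there (there (there (here p)))) }
    1≢k : 1 ≢ k
    1≢k refl = contradiction (≤-trans 3≤m (subst (m ≤_) (sym 2k≡) (ℕ.m≤m+n m j))) λ { (s≤s (s≤s ())) }
    only-h : ∀ {b y} → Adj G a b → (b , y) ∈ (h , k) ∷ (v , 0) ∷ (o , j) ∷ [] → b ≡ h × y ≡ k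
    only-h ab (here refl) = refl , refl
    only-h ab (there (here refl)) = contradiction (here (only-stem (Adj-sym ab))) a∉
    only-h ab (there (there (here refl))) = contradiction ab (triangle-free (all-h a∉) ho)
    v≁ : ∀ {b} → b ≢ u → ¬ Adj G v b
    v≁ b≢u vb = b≢u (only-stem vb)
    old : ∀ {b c y z} → Adj G b c → (b , y) ∈ (h , k) ∷ (v , 0) ∷ (o , j) ∷ [] →
          (c , z) ∈ (h , k) ∷ (v , 0) ∷ (o , j) ∷ [] → ∣ y - z ∣ ≡ ∣ k - j ∣
    old bc (here refl) (here refl) = contradiction bc loopless
    old bc (here refl) (there (here refl)) = contradiction (Adj-sym bc) (v≁ h≢u)
    old bc (here refl) (there (there (here refl))) = refl
    old bc (there (here refl)) (here refl) = contradiction bc (v≁ h≢u)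
    old bc (there (here refl)) (there (here refl)) = contradiction bc loopless
    old bc (there (here refl)) (there (there (here refl))) = contradiction bc (v≁ o≢u)
    old bc (there (there (here refl))) (here refl) = ℕ.∣-∣-comm j k
    old bc (there (there (here refl))) (there (here refl)) = contradiction (Adj-sym bc) (v≁ o≢u)
    old bc (there (there (here refl))) (there (there (here refl))) = contradiction bc loopless
    new-old : ∣ k - 1 ∣ ≢ ∣ k - j ∣
    new-old eq with ∣a-b∣≡∣a-c∣⇒ k 1 j eq
    ... | inj₁ 1≡j = j≢1 (sym 1≡j)
    ... | inj₂ 2k≡1+j = 1≢m (ℕ.+-cancelʳ-≡ j 1 m (trans (sym 2k≡1+j) 2k≡))
  -- Every vertex off the list is adjacent to both `u` and `h`. Two of them would close a square, so
  -- only `x` is left; among the five vertices `v′` can only be `o`, and this is the excluded path.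
  ...   | no none = ⊥-elim (path (cover v′))
    where
    open Fork fk
    all-u : ∀ {a} → a ∉ u ∷ v ∷ h ∷ o ∷ [] → Adj G a u
    all-u {a} a∉ = decidable-stable (adj? a u) λ a≁u → none (a , a∉ , a≁u)
    cover : ∀ a → a ∈ x ∷ u ∷ v ∷ h ∷ o ∷ []
    cover a with a ∈? (u ∷ v ∷ h ∷ o ∷ [])
    ... | yes a∈ = there a∈
    ... | no a∉ = here (square-free (λ p → h≢u (sym p)) (Adj-sym (all-u a∉)) (all-h a∉) (Adj-sym (all-u x∉)) (all-h x∉))
    path : v′ ∈ x ∷ u ∷ v ∷ h ∷ o ∷ [] → ⊥
    path (here refl) = h≢u (trans (only-stem′ (all-h x∉)) (sym (only-stem′ (all-u x∉))))
    path (there (here p)) = v′≢u p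
    path (there (there (here p))) = v≢v′ (sym p)
    path (there (there (there (here refl)))) =
      x∉ (there (there (there (here (trans (only-stem′ (Adj-sym (all-h x∉))) (sym (only-stem′ ho)))))))
    path (there (there (there (there (here p))))) =
      not-path (sym p) (only-stem′ (subst (λ a → Adj G a h) (sym p) (Adj-sym ho))) (h≁u ∘ Adj-sym)
        (ℕ.≤-pred (cover⇒≤length cover))

-- The generic opening, answered by `0` at a leaf

-- Makes the two ways of blocking `m` exclusive: `l + l ≡ m + k` needs `k < l`, and `k + k ≡ m + l`
-- needs `l < k`.
a+a≡n+b⇒b<a : ∀ {a b n} → a < n → a + a ≡ n + b → b < a
a+a≡n+b⇒b<a {a} {b} {n} a<n eq = ℕ.≰⇒> λ a≤b → ℕ.<-irrefl eq (ℕ.+-mono-<-≤ a<n a≤b)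

module OpeningMove {G : Graph} (T : RootedTree G) where
  open Graph G
  open Position G
  open Tree T
  open Labelled T
  open Strategy T
  open AliceOpens T

  -- Alice has opened with `l` at `w` and Bob answers `0` at `v`. The condition `2l≢1+m` says that
  -- `l` is not the midpoint of `1` and `m`, the two labels that Bob may want to place.
  module Generic {v u v′ u′ : V} (fk : Fork v u v′ u′) {w : V} {l : ℕ}
    (w≢u : w ≢ u) (w≢v : w ≢ v) (w≢u′ : w ≢ u′) (2≤l : 2 ≤ l) (l<m : l < m)
    (2l≢1+m : l + l ≢ suc m) where
    open Fork fk

    l≤m : l ≤ m
    l≤m = ℕ.<⇒≤ l<m

    l≢0 : l ≢ 0
    l≢0 refl = contradiction 2≤l λ ()

    l≢1 : l ≢ 1
    l≢1 refl = contradiction 2≤l λ { (s≤s ()) }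

    v≢w : v ≢ w
    v≢w p = w≢v (sym p)

    f₁ f₂ : Labeling G
    f₁ = assign G (empty G) w l
    f₂ = assign G f₁ v 0

    legal₂ : Legal G f₁ v 0
    legal₂ = second-legal l≤m z≤n v≢w (λ p → l≢0 (sym p))

    val₂ : Valid f₂
    val₂ = valid-assign (first-valid l≤m) legal₂

    f₂v : f₂ v ≡ just 0
    f₂v = assign-same f₁ v 0

    f₂w : f₂ w ≡ just l
    f₂w = trans (assign-other f₁ 0 w≢v) (assign-same (empty G) w l)

    on₂ : On f₂ ((v , 0) ∷ (w , l) ∷ [])
    on₂ = on-assign v 0 (on-assign w l on-empty)

    f₂-incomplete : ¬ Complete G f₂
    f₂-incomplete total with trans (sym (on-free on₂ u∉)) (proj₂ (total u))
      where
      u∉ : u ∉ v ∷ w ∷ []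
      u∉ (here p) = v≢u (sym p)
      u∉ (there (here p)) = w≢u (sym p)
    ... | ()

    -- Alice has placed the forced `m` at `u`, so Bob now aims for `1` away from the neighbours of
    -- `u`.
    module AfterMax (legal : Legal G f₂ u m) where
      f₃ : Labeling G
      f₃ = assign G f₂ u m

      val₃ : Valid f₃
      val₃ = valid-assign val₂ legal

      ps : List (V × ℕ)
      ps = (u , m) ∷ (v , 0) ∷ (w , l) ∷ []

      on₃ : On f₃ ps
      on₃ = on-assign u m on₂

      1-fresh : ∀ a → f₃ a ≢ just 1
      1-fresh = on-fresh on₃ λ { (here p) → 1≢m p ; (there (here ())) ; (there (there (here p))) → l≢1 (sym p) }

      old : ∀ {b c y z} → Adj G b c → (b , y) ∈ ps → (c , z) ∈ ps →
            ∣ y - z ∣ ≡ m ⊎ (Adj G w u × ∣ y - z ∣ ≡ ∣ l - m ∣)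
      old bc (here refl) (here refl) = contradiction bc loopless
      old bc (here refl) (there (here refl)) = inj₁ (ℕ.∣-∣-identityʳ m)
      old bc (here refl) (there (there (here refl))) = inj₂ (Adj-sym bc , ℕ.∣-∣-comm m l)
      old bc (there (here refl)) (here refl) = inj₁ refl
      old bc (there (here refl)) (there (here refl)) = contradiction bc loopless
      old bc (there (here refl)) (there (there (here refl))) = contradiction (only-stem bc) w≢u
      old bc (there (there (here refl))) (here refl) = inj₂ (bc , refl)
      old bc (there (there (here refl))) (there (here refl)) = contradiction (only-stem (Adj-sym bc)) w≢u
      old bc (there (there (here refl))) (there (there (here refl))) = contradiction bc loopless

      ∣l-1∣≢m : ∣ l - 1 ∣ ≢ m
      ∣l-1∣≢m = ℕ.<⇒≢ (∣k-1∣<n (≤-trans (s≤s z≤n) 2≤l) l<m)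

      ∣l-1∣≢∣l-m∣ : ∣ l - 1 ∣ ≢ ∣ l - m ∣
      ∣l-1∣≢∣l-m∣ eq with ∣a-b∣≡∣a-c∣⇒ l 1 m eq
      ... | inj₁ p = 1≢m p
      ... | inj₂ p = 2l≢1+m p

      -- Only `w` can be a labelled neighbour of `x`. The possible new edge label `l - 1` differs
      -- from `m`, and from `m - l` by `2l≢1+m`.
      1-away : ∀ {x} → x ∉ u ∷ v ∷ w ∷ [] → ¬ Adj G x u → BobWins G Bob f₃
      1-away {x} x∉ x≁u = wins-by-dooming val₃
        (extend-legal val₃ (on-free on₃ x∉) (≤-trans (s≤s z≤n) 3≤m) 1-fresh
          (λ ab p ac q _ → trans (proj₁ (only-w ab (on₃ p))) (sym (proj₁ (only-w ac (on₃ q)))))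
          new-old)
        λ gr ext → let (gx , ext₃) = extends-assign (on-free on₃ x∉) ext
                       (_ , ext₂) = extends-assign (proj₁ legal) ext₃
                   in x≁u (leaf-0⇒1-adj gr 2≤m leaf (ext₂ f₂v) gx)
        where
        only-w : ∀ {b y} → Adj G x b → (b , y) ∈ ps → b ≡ w × y ≡ l
        only-w xb (here refl) = contradiction xb x≁u
        only-w xb (there (here refl)) = contradiction (here (only-stem (Adj-sym xb))) x∉
        only-w xb (there (there (here refl))) = refl , refl
        new-old : ∀ {a b c y y₁ y₂} → Adj G x a → f₃ a ≡ just y → Adj G b c → f₃ b ≡ just y₁ → f₃ c ≡ just y₂ →
                  ∣ y - 1 ∣ ≢ ∣ y₁ - y₂ ∣
        new-old xa p bc q r eq with refl ← proj₂ (only-w xa (on₃ p)) with old bc (on₃ q) (on₃ r)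
        ... | inj₁ k≡m = ∣l-1∣≢m (trans eq k≡m)
        ... | inj₂ (_ , k≡) = ∣l-1∣≢∣l-m∣ (trans eq k≡)

      -- After 1 at u′, the label m + 1 − l would repeat at u the label of the edge u′v′.
      spider : (∀ {x} → x ∉ u ∷ v ∷ w ∷ [] → Adj G x u) → BobWins G Bob f₃
      spider all-u with v′ ≟V w
      ... | no v′≢w = contradiction (only-stem′ (all-u v′∉)) u≢u′
        where
        v′∉ : v′ ∉ u ∷ v ∷ w ∷ []
        v′∉ (here p) = v′≢u p
        v′∉ (there (here p)) = v≢v′ (sym p)
        v′∉ (there (there (here p))) = v′≢w p
      ... | yes refl = wins-by-dooming val₃
        (extend-legal val₃ (on-free on₃ u′∉) (≤-trans (s≤s z≤n) 3≤m) 1-fresh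
          (λ ab p ac q eq → Valid.injective val₃ p (trans q (cong just (sym (new-new ab (on₃ p) ac (on₃ q) eq)))))
          new-old)
        λ gr ext → let (gu′ , ext₃) = extends-assign (on-free on₃ u′∉) ext
                       (gu , ext₂) = extends-assign (proj₁ legal) ext₃
                   in doom gr gu′ gu (ext₂ f₂v) (ext₂ f₂w)
        where
        u′∉ : u′ ∉ u ∷ v ∷ w ∷ []
        u′∉ (here p) = u≢u′ (sym p)
        u′∉ (there (here p)) = v≢u′ (sym p)
        u′∉ (there (there (here p))) = w≢u′ (sym p)
        u′≁v : ¬ Adj G u′ v
        u′≁v adj = u≢u′ (sym (only-stem (Adj-sym adj)))
        w≁u : ¬ Adj G w u
        w≁u adj = u≢u′ (only-stem′ adj)
        1≤l = ≤-trans (s≤s z≤n) 2≤l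
        m≢l : ∣ m - 1 ∣ ≢ ∣ l - 1 ∣
        m≢l eq with ∣a-b∣≡∣a-c∣⇒ 1 m l (trans (ℕ.∣-∣-comm 1 m) (trans eq (ℕ.∣-∣-comm l 1)))
        ... | inj₁ p = ℕ.<⇒≢ l<m (sym p)
        ... | inj₂ p = contradiction (subst (m ≤_) (sym p) (ℕ.m≤m+n m l)) (ℕ.<⇒≱ 3≤m)
        new-new : ∀ {a b y z} → Adj G u′ a → (a , y) ∈ ps → Adj G u′ b → (b , z) ∈ ps →
                  ∣ y - 1 ∣ ≡ ∣ z - 1 ∣ → y ≡ z
        new-new _  (here refl) _  (here refl) _ = refl
        new-new _  (here refl) _  (there (there (here refl))) eq = contradiction eq m≢l
        new-new _  (there (there (here refl))) _ (here refl) eq = contradiction (sym eq) m≢l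
        new-new _  (there (there (here refl))) _ (there (there (here refl))) _ = refl
        new-new ua (there (here refl)) _ _ _ = contradiction ua u′≁v
        new-new _  _ ub (there (here refl)) _ = contradiction ub u′≁v
        ∣m-1∣≢m : ∣ m - 1 ∣ ≢ m
        ∣m-1∣≢m eq with ∣a-b∣≡∣a-c∣⇒ m 1 0 (trans eq (sym (ℕ.∣-∣-identityʳ m)))
        ... | inj₂ p = contradiction (subst (m ≤_) p (ℕ.m≤m+n m m)) (ℕ.<⇒≱ 2≤m)
        new-old : ∀ {a b c y y₁ y₂} → Adj G u′ a → f₃ a ≡ just y → Adj G b c → f₃ b ≡ just y₁ → f₃ c ≡ just y₂ →
                  ∣ y - 1 ∣ ≢ ∣ y₁ - y₂ ∣
        new-old ua p bc q r eq with old bc (on₃ q) (on₃ r)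
        ... | inj₂ (wu , _) = w≁u wu
        ... | inj₁ k≡m with on₃ p
        ...   | here refl = ∣m-1∣≢m (trans eq k≡m)
        ...   | there (here refl) = u′≁v ua
        ...   | there (there (here refl)) = ∣l-1∣≢m (trans eq k≡m)
        d = suc (m ∸ l)
        d+l≡1+m : d + l ≡ suc m
        d+l≡1+m = cong suc (ℕ.m∸n+n≡m l≤m)
        d≤m : d ≤ m
        d≤m = ℕ.+-cancelʳ-≤ 1 d m (≤-trans (ℕ.+-monoʳ-≤ d 1≤l) (≤-reflexive (trans d+l≡1+m (+-comm 1 m))))
        doom : ∀ {g} → Graceful g → g u′ ≡ 1 → g u ≡ m → g v ≡ 0 → g w ≡ l → ⊥
        doom {g} gr gu′ gu gv gw with onto gr d≤m
        ... | z , gz with z ∈? (u ∷ v ∷ w ∷ [])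
        ...   | yes (here refl) = l≢1 (ℕ.+-cancelˡ-≡ m l 1 (trans (cong (_+ l) (trans (sym gu) gz)) (trans d+l≡1+m (+-comm 1 m))))
        ...   | yes (there (here refl)) = contradiction (trans (sym gv) gz) λ ()
        ...   | yes (there (there (here refl))) = 2l≢1+m (trans (cong (_+ l) (trans (sym gw) gz)) d+l≡1+m)
        ...   | no z∉ with clash-free gr (all-u z∉) (Adj-sym stem′)
                (trans (cong₂ ∣_-_∣ gz gu) (trans (∣-∣-reflect d m d+l≡1+m (+-comm m 1))
                  (trans (ℕ.∣-∣-comm l 1) (sym (cong₂ ∣_-_∣ gu′ gw)))))
        ...     | inj₁ (_ , u≡w) = w≢u (sym u≡w)
        ...     | inj₂ (_ , u≡u′) = u≢u′ u≡u′

      bob-answers : BobWins G Bob f₃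
      bob-answers with anyV? (λ x → ¬? (x ∈? (u ∷ v ∷ w ∷ [])) ×-dec ¬? (adj? x u))
      ... | yes (x , x∉ , x≁u) = 1-away x∉ x≁u
      ... | no none = spider λ {x} x∉ → decidable-stable (adj? x u) λ x≁u → none (x , x∉ , x≁u)

    module AfterOther (not-path : m ≡ 4 → l ≡ 2 → w ≡ v′ → ¬ Adj G u u′ → ⊥)
                      {z : V} {k : ℕ} (legal : Legal G f₂ z k) (z≢u : z ≢ u) (k≢m : k ≢ m) where
      f₃ : Labeling G
      f₃ = assign G f₂ z k

      val₃ : Valid f₃
      val₃ = valid-assign val₂ legal

      k≤m : k ≤ m
      k≤m = proj₁ (proj₂ legal)

      k<m : k < m
      k<m = ℕ.≤∧≢⇒< k≤m k≢m

      ps : List (V × ℕ)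
      ps = (z , k) ∷ (v , 0) ∷ (w , l) ∷ []

      on₃ : On f₃ ps
      on₃ = on-assign z k on₂

      z≢v : z ≢ v
      z≢v = proj₁ (assign-free f₁ v 0 (proj₁ legal))

      z≢w : z ≢ w
      z≢w = proj₁ (assign-free (empty G) w l (proj₂ (assign-free f₁ v 0 (proj₁ legal))))

      f₃z : f₃ z ≡ just k
      f₃z = assign-same f₂ z k

      f₃v : f₃ v ≡ just 0
      f₃v = trans (assign-other f₂ k (λ p → z≢v (sym p))) f₂v

      f₃w : f₃ w ≡ just l
      f₃w = trans (assign-other f₂ k (λ p → z≢w (sym p))) f₂w

      old : ∀ {b c x y} → Adj G b c → (b , x) ∈ ps → (c , y) ∈ ps → Adj G z w × ∣ x - y ∣ ≡ ∣ l - k ∣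
      old bc (here refl) (here refl) = contradiction bc loopless
      old bc (here refl) (there (here refl)) = contradiction (only-stem (Adj-sym bc)) z≢u
      old bc (here refl) (there (there (here refl))) = bc , ℕ.∣-∣-comm k l
      old bc (there (here refl)) (here refl) = contradiction (only-stem bc) z≢u
      old bc (there (here refl)) (there (here refl)) = contradiction bc loopless
      old bc (there (here refl)) (there (there (here refl))) = contradiction (only-stem bc) w≢u
      old bc (there (there (here refl))) (here refl) = Adj-sym bc , refl
      old bc (there (there (here refl))) (there (here refl)) = contradiction (only-stem (Adj-sym bc)) w≢u
      old bc (there (there (here refl))) (there (there (here refl))) = contradiction bc loopless

      others : List V
      others = u ∷ v ∷ w ∷ z ∷ []

      -- How `m` at `x` can clash: `z w` is the only edge that can be labelled so far, and a new
      -- edge from `x` to `w` or `z` repeats its label when the label of that end is the midpoint of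
      -- `m` and the label of the other end.
      Blocked : V → Set
      Blocked x = Adj G z w × ((Adj G x w × l + l ≡ m + k) ⊎ (Adj G x z × k + k ≡ m + l))

      blocked? : ∀ x → Dec (Blocked x)
      blocked? x = adj? z w ×-dec ((adj? x w ×-dec l + l ℕ.≟ m + k) ⊎-dec (adj? x z ×-dec k + k ℕ.≟ m + l))

      m-away : ∀ {x} → x ∉ others → ¬ Blocked x → BobWins G Bob f₃
      m-away {x} x∉ unblocked = wins-by-dooming val₃
        (extend-legal val₃ free ≤-refl
          (on-fresh on₃ λ { (here p) → k≢m (sym p) ; (there (here p)) → 0≢m (sym p)
                          ; (there (there (here p))) → ℕ.<⇒≢ l<m (sym p) })
          (λ _ p _ q eq → Valid.injective val₃ p (trans q (cong just
             (sym (∣x-n∣-injective (Valid.bounded val₃ p) (Valid.bounded val₃ q) eq)))))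
          new-old)
        λ gr ext → let (gx , ext₃) = extends-assign free ext in
          x∉ (here (Graceful.injective gr (trans gx (sym (leaf-0⇒stem-m gr leaf (ext₃ f₃v))))))
        where
        free : f₃ x ≡ nothing
        free = on-free on₃ λ { (here p) → x∉ (there (there (there (here p)))) ; (there (here p)) → x∉ (there (here p))
                             ; (there (there (here p))) → x∉ (there (there (here p))) }
        new-old : ∀ {a b c y y₁ y₂} → Adj G x a → f₃ a ≡ just y → Adj G b c → f₃ b ≡ just y₁ → f₃ c ≡ just y₂ →
                  ∣ y - m ∣ ≢ ∣ y₁ - y₂ ∣
        new-old xa p bc q r eq with old bc (on₃ q) (on₃ r) | on₃ p
        ... | zw , k≡ | there (here refl) = x∉ (here (only-stem (Adj-sym xa)))
        ... | zw , k≡ | here refl with ∣a-b∣≡∣a-c∣⇒ k m l (trans eq (trans k≡ (ℕ.∣-∣-comm l k)))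
        ...   | inj₁ m≡l = ℕ.<⇒≢ l<m (sym m≡l)
        ...   | inj₂ 2k≡ = unblocked (zw , inj₂ (xa , 2k≡))
        new-old xa p bc q r eq | zw , k≡ | there (there (here refl)) with ∣a-b∣≡∣a-c∣⇒ l m k (trans eq k≡)
        ...   | inj₁ m≡k = k≢m (sym m≡k)
        ...   | inj₂ 2l≡ = unblocked (zw , inj₁ (xa , 2l≡))

      swap-∈ : ∀ {x a b} → x ∈ u ∷ v ∷ a ∷ b ∷ [] → x ∈ u ∷ v ∷ b ∷ a ∷ []
      swap-∈ (here p) = here p
      swap-∈ (there (here p)) = there (here p)
      swap-∈ (there (there (here p))) = there (there (there (here p)))
      swap-∈ (there (there (there (here p)))) = there (there (here p))

      -- The equations in `Blocked` do not depend on the vertex and exclude each other. Hence all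
      -- blocked vertices are adjacent to the same one of `w` and `z`, which becomes the hub.
      all-blocked : ∀ {x₀} → x₀ ∉ others → (∀ {x} → x ∉ others → Blocked x) → BobWins G Bob f₃
      all-blocked {x₀} x₀∉ blocked with blocked x₀∉
      ... | zw , inj₁ (_ , 2l≡) =
        hub fk val₃ f₃w f₃v f₃z on₃′ (Adj-sym zw) 2l≡ k≢1 w≢u z≢u (x₀ , x₀∉) all-w
          (λ _ w≡u′ _ _ → w≢u′ w≡u′)
        where
        on₃′ : On f₃ ((w , l) ∷ (v , 0) ∷ (z , k) ∷ [])
        on₃′ p with on₃ p
        ... | here q = there (there (here q))
        ... | there (here q) = there (here q)
        ... | there (there (here q)) = here q
        k≢1 : k ≢ 1
        k≢1 refl = 2l≢1+m (trans 2l≡ (+-comm m 1))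
        all-w : ∀ {x} → x ∉ others → Adj G x w
        all-w x∉ with blocked x∉
        ... | _ , inj₁ (xw , _) = xw
        ... | _ , inj₂ (_ , 2k≡) = contradiction (a+a≡n+b⇒b<a l<m 2l≡) (ℕ.<-asym (a+a≡n+b⇒b<a k<m 2k≡))
      ... | zw , inj₂ (_ , 2k≡) =
        hub fk val₃ f₃z f₃v f₃w on₃ zw 2k≡ l≢1 z≢u w≢u (x₀ , x₀∉ ∘ swap-∈) all-z
          -- From `2 ≤ l < k < m ≤ 4` follow `m ≡ 4` and `l ≡ 2`, the case that `not-path` excludes.
          λ { w≡v′ refl u≁z m≤4 → not-path (≤-antisym m≤4 (≤-trans (s≤s (s≤s 2≤l)) l+2≤m))
                (≤-antisym (ℕ.≤-pred (ℕ.≤-pred (≤-trans l+2≤m m≤4))) 2≤l) w≡v′ u≁z }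
        where
        l<k : l < k
        l<k = a+a≡n+b⇒b<a k<m 2k≡
        l+2≤m : suc (suc l) ≤ m
        l+2≤m = ≤-trans (s≤s l<k) k<m
        all-z : ∀ {x} → x ∉ u ∷ v ∷ z ∷ w ∷ [] → Adj G x z
        all-z x∉ with blocked (x∉ ∘ swap-∈)
        ... | _ , inj₂ (xz , _) = xz
        ... | _ , inj₁ (_ , 2l≡) = contradiction (a+a≡n+b⇒b<a l<m 2l≡) (ℕ.<-asym l<k)

      bob-answers : BobWins G Bob f₃
      bob-answers with anyV? (λ x → ¬? (x ∈? others) ×-dec ¬? (blocked? x)) | anyV? (λ x → ¬? (x ∈? others))
      ... | yes (x , x∉ , unblocked) | _ = m-away x∉ unblocked
      ... | no none | yes (x₀ , x₀∉) = all-blocked x₀∉ λ {x} x∉ →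
              decidable-stable (blocked? x) λ unblocked → none (x , x∉ , unblocked)
      -- A tree of only four vertices has `m ≡ 3`, hence `l ≡ 2`, against `2l≢1+m`.
      ... | no _ | no none = contradiction (trans (cong₂ _+_ l≡2 l≡2) (cong suc (sym m≡3))) 2l≢1+m
        where
        m≤3 : m ≤ 3
        m≤3 = ℕ.≤-pred (cover⇒≤length λ a → decidable-stable (a ∈? others) λ a∉ → none (a , a∉))
        m≡3 : m ≡ 3
        m≡3 = ≤-antisym m≤3 3≤m
        l≡2 : l ≡ 2
        l≡2 = ≤-antisym (ℕ.≤-pred (≤-trans l<m m≤3)) 2≤l

    -- If exactly one of `z ≡ u` and `k ≡ m` holds, Alice's reply contradicts the forced `m` at `u`.
    -- The cases of both and of neither are those of the two inner modules.
    opening-generic : (m ≡ 4 → l ≡ 2 → w ≡ v′ → ¬ Adj G u u′ → ⊥) → BobWins G Bob f₁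
    opening-generic not-path = bob-move v 0 legal₂ (alice f₂-incomplete reply)
      where
      reply : ∀ z k → Legal G f₂ z k → BobWins G Bob (assign G f₂ z k)
      reply z k legal with z ≟V u | k ℕ.≟ m
      ... | yes refl | yes refl = AfterMax.bob-answers legal
      ... | yes refl | no k≢m = doomed⇒bobWins (valid-assign val₂ legal)
              (λ gr ext → let (gu , ext₂) = extends-assign (proj₁ legal) ext in
                k≢m (trans (sym gu) (leaf-0⇒stem-m gr leaf (ext₂ f₂v)))) Bob
      ... | no z≢u | yes refl = doomed⇒bobWins (valid-assign val₂ legal)
              (λ gr ext → let (gz , ext₂) = extends-assign (proj₁ legal) ext in
                z≢u (Graceful.injective gr (trans gz (sym (leaf-0⇒stem-m gr leaf (ext₂ f₂v)))))) Bob
      ... | no z≢u | no k≢m = AfterOther.bob-answers not-path legal z≢u k≢m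

  open Generic public using (opening-generic)

  mirror-opening : ∀ {w l} → l ≤ m → BobWins G Bob (assign G (empty G) w (m ∸ l)) →
                   BobWins G Bob (assign G (empty G) w l)
  mirror-opening l≤m = bobWins-mirror (mirror-assign (λ _ → inj₁ (refl , refl)) (ℕ.m∸n+n≡m l≤m))

-- All openings, by mirror symmetry

complement-half : ∀ {l l′ n} → l′ + l ≡ n → l + l ≡ suc n → l ≡ suc l′
complement-half {l} {l′} eq 2l≡ = ℕ.+-cancelʳ-≡ l l (suc l′) (trans 2l≡ (cong suc (sym eq)))

-- Justifies the assumption `2l ≢ m + 1`: a label that violates it exceeds its complement by one, so
-- the complement satisfies it.
complement-half≢ : ∀ {l l′ n} → l′ + l ≡ n → l + l ≡ suc n → l′ + l′ ≢ suc n
complement-half≢ {l} {l′} eq 2l≡ 2l′≡ with complement-half {l} {l′} eq 2l≡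
... | refl = ℕ.<⇒≢ (ℕ.+-mono-< {l′} ≤-refl ≤-refl) (trans 2l′≡ (sym 2l≡))

module Conclusion {G : Graph} (T : RootedTree G) where
  open Graph G
  open Position G
  open Tree T
  open Strategy T
  open AliceOpens T
  open OpeningMove T

  -- Alice has taken one leaf of the fork, so Bob's `0` goes on the other, except in the path
  -- position.
  opening-leaf-upright : ∀ {v u v′ u′ l} → Fork v u v′ u′ → 0 < l → l < m → l + l ≢ suc m →
                         BobWins G Bob (assign G (empty G) v′ l)
  opening-leaf-upright {v} {u} {v′} {u′} {l} fk 0<l l<m 2l≢
    with l ℕ.≟ 1 | m ℕ.≟ 4 ×-dec l ℕ.≟ 2 ×-dec ¬? (adj? u u′)
  ... | yes refl | _ = opening-1 fk (λ p → v≢v′ (sym p)) (λ adj → u≢u′ (only-stem′ adj))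
    where open Fork fk
  ... | no _ | yes (m≡4 , refl , u≁u′) = opening-path fk m≡4 u≁u′
  ... | no l≢1 | no not-path = opening-generic fk v′≢u (λ p → v≢v′ (sym p)) v′≢u′
          (ℕ.≤∧≢⇒< 0<l (λ p → l≢1 (sym p))) l<m 2l≢ λ m≡4 l≡2 _ u≁u′ → not-path (m≡4 , l≡2 , u≁u′)
    where open Fork fk

  opening-leaf : ∀ {v u v′ u′ l} → Fork v u v′ u′ → 0 < l → l < m → BobWins G Bob (assign G (empty G) v′ l)
  opening-leaf {l = l} fk 0<l l<m with l + l ℕ.≟ suc m
  ... | no 2l≢ = opening-leaf-upright fk 0<l l<m 2l≢
  ... | yes 2l≡ = mirror-opening (ℕ.<⇒≤ l<m) (opening-leaf-upright fk (ℕ.m<n⇒0<n∸m l<m)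
          (ℕ.∸-monoʳ-< 0<l (ℕ.<⇒≤ l<m)) (complement-half≢ {l} {m ∸ l} (ℕ.m∸n+n≡m (ℕ.<⇒≤ l<m)) 2l≡))

  -- Since `w` may be adjacent to `u`, the label `1` is not left to `opening-1` but mirrored to
  -- `m - 1`. Five distinct vertices give `4 ≤ m`, which makes the mirrored label large enough.
  opening-inner : ∀ {v u v′ u′ w l} → Fork v u v′ u′ → w ≢ v → w ≢ u → w ≢ v′ → w ≢ u′ →
                  0 < l → l < m → BobWins G Bob (assign G (empty G) w l)
  opening-inner {w = w} {l} fk w≢v w≢u w≢v′ w≢u′ 0<l l<m = choose (l ℕ.≟ 1) (l + l ℕ.≟ suc m)
    where
    open Fork fk
    4≤m : 4 ≤ m
    4≤m = ℕ.≤-pred (unique⇒length≤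
      ((w≢v ∷ w≢u ∷ w≢v′ ∷ w≢u′ ∷ []) ∷
       (v≢u ∷ v≢v′ ∷ v≢u′ ∷ []) ∷ ((λ p → v′≢u (sym p)) ∷ u≢u′ ∷ []) ∷ (v′≢u′ ∷ []) ∷ [] ∷ []))
    generic : ∀ {l} → 2 ≤ l → l < m → l + l ≢ suc m → BobWins G Bob (assign G (empty G) w l)
    generic 2≤l l<m 2l≢ = opening-generic fk w≢u w≢v w≢u′ 2≤l l<m 2l≢ λ _ _ w≡v′ _ → w≢v′ w≡v′
    l′ = m ∸ l
    l′+l≡m : l′ + l ≡ m
    l′+l≡m = ℕ.m∸n+n≡m (ℕ.<⇒≤ l<m)
    mirrored : 2 ≤ l′ → l′ + l′ ≢ suc m → BobWins G Bob (assign G (empty G) w l)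
    mirrored 2≤l′ 2l′≢ = mirror-opening (ℕ.<⇒≤ l<m) (generic 2≤l′ (ℕ.∸-monoʳ-< 0<l (ℕ.<⇒≤ l<m)) 2l′≢)
    choose : Dec (l ≡ 1) → Dec (l + l ≡ suc m) → BobWins G Bob (assign G (empty G) w l)
    choose (no l≢1) (no 2l≢) = generic (ℕ.≤∧≢⇒< 0<l (λ p → l≢1 (sym p))) l<m 2l≢
    -- Here `m` is `l′ + 1`, so `l′ + l′ ≡ suc m` would mean `l′ ≡ 2`.
    choose (yes l≡1) _ = mirrored (≤-trans (s≤s (s≤s z≤n)) 3≤l′) λ 2l′≡ →
      ℕ.<⇒≢ (≤-trans (s≤s ≤-refl) 3≤l′)
        (sym (ℕ.+-cancelˡ-≡ l′ l′ 2 (trans 2l′≡ (trans (cong suc (sym l′+1≡m)) (sym (+-suc l′ 1))))))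
      where
      l′+1≡m : l′ + 1 ≡ m
      l′+1≡m = subst (λ k → l′ + k ≡ m) l≡1 l′+l≡m
      3≤l′ : 3 ≤ l′
      3≤l′ = ℕ.+-cancelʳ-≤ 1 3 l′ (subst (4 ≤_) (sym l′+1≡m) 4≤m)
    choose (no _) (yes 2l≡) = mirrored 2≤l′ (complement-half≢ {l} {l′} l′+l≡m 2l≡)
      where
      2≤l′ : 2 ≤ l′
      2≤l′ = ℕ.≰⇒> λ l′≤1 → ℕ.<⇒≱ 4≤m (subst (_≤ 3) l′+l≡m
        (ℕ.+-mono-≤ l′≤1 (subst (_≤ 2) (sym (complement-half l′+l≡m 2l≡)) (s≤s l′≤1))))

  opening : ∀ {v u v′ u′} → Fork v u v′ u′ → ∀ w l → l ≤ m → BobWins G Bob (assign G (empty G) w l)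
  opening {v} {u} {v′} {u′} fk w l l≤m with l ℕ.≟ 0 | l ℕ.≟ m
  ... | yes refl | _ = opening-0 fk w
  ... | no _ | yes refl = mirror-opening ≤-refl (subst (λ k → BobWins G Bob (assign G (empty G) w k)) (sym (ℕ.n∸n≡0 m)) (opening-0 fk w))
  ... | no l≢0 | no l≢m with w ≟V u | w ≟V u′ | w ≟V v | w ≟V v′
  ...   | yes refl | _ | _ | _ = opening-stem leaf l≤m l≢0 l≢m
    where open Fork fk
  ...   | no _ | yes refl | _ | _ = opening-stem leaf′ l≤m l≢0 l≢m
    where open Fork fk
  ...   | no _ | no _ | yes refl | _ = opening-leaf (fork-swap fk) (ℕ.n≢0⇒n>0 l≢0) (ℕ.≤∧≢⇒< l≤m l≢m)
  ...   | no _ | no _ | no _ | yes refl = opening-leaf fk (ℕ.n≢0⇒n>0 l≢0) (ℕ.≤∧≢⇒< l≤m l≢m)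
  ...   | no w≢u | no w≢u′ | no w≢v | no w≢v′ =
    opening-inner fk w≢v w≢u w≢v′ w≢u′ (ℕ.n≢0⇒n>0 l≢0) (ℕ.≤∧≢⇒< l≤m l≢m)

  fork⇒bobWins : ∀ {v u v′ u′} → Fork v u v′ u′ → ∀ p → BobWins G p (empty G)
  fork⇒bobWins fk Bob = bob-first fk
  fork⇒bobWins {v} fk Alice = alice (λ total → contradiction (proj₂ (total v)) λ ())
    λ w l legal → opening fk w l (proj₁ (proj₂ legal))

-- Caterpillars as rooted trees with a fork

leaf↔ : ∀ {n} (ks : Vec ℕ n) → Fin (Vec.sum ks) ↔ Σ (Fin n) (λ j → Fin (Vec.lookup ks j))
leaf↔ []       = mk↔ₛ′ (λ ()) (λ ()) (λ ()) (λ ())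
leaf↔ (k ∷ ks) = (split ↔-∘ (↔-id (Fin k) ⊎-↔ leaf↔ ks)) ↔-∘ Fin.+↔⊎
  where
  split : (Fin k ⊎ Σ (Fin _) (λ j → Fin (Vec.lookup ks j))) ↔ Σ (Fin _) (λ j → Fin (Vec.lookup (k ∷ ks) j))
  split = mk↔ₛ′
    (λ { (inj₁ i) → Fin.zero , i ; (inj₂ (j , i)) → Fin.suc j , i })
    (λ { (Fin.zero , i) → inj₁ i ; (Fin.suc j , i) → inj₂ (j , i) })
    (λ { (Fin.zero , i) → refl ; (Fin.suc j , i) → refl })
    (λ { (inj₁ i) → refl ; (inj₂ (j , i)) → refl })

-- The root is the first spine vertex, and heights are distances from it.
catTree : ∀ {t} (ks : Vec ℕ (suc t)) → RootedTree (cat ks)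
catTree {t} ks = record
  { enumV = (↔-id (Fin (suc t)) ⊎-↔ leaf↔ ks) ↔-∘ Fin.+↔⊎
  ; enumE = (↔-id (Fin t) ⊎-↔ leaf↔ ks) ↔-∘ Fin.+↔⊎
  ; height = λ { (inj₁ j) → toℕ j ; (inj₂ (j , _)) → suc (toℕ j) }
  ; height-step = λ { (inj₁ i) → cong suc (sym (Fin.toℕ-inject₁ i)) ; (inj₂ _) → refl }
  ; parent-unique = λ { (inj₁ _) (inj₁ _) refl → refl ; (inj₁ _) (inj₂ _) () ; (inj₂ _) (inj₁ _) ()
                      ; (inj₂ _) (inj₂ _) refl → refl } }

-- Any two vertices are joined through `c` by at most two edges. This rules out the stars among the
-- short spines.
dominating⇒¬diamGe3 : ∀ G {c} → (∀ a → a ≡ c ⊎ Adj G c a) → ¬ DiamGe3 G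
dominating⇒¬diamGe3 G dom (a , b , a≢b , a≁b , no-path) with dom a | dom b
... | inj₁ refl | inj₁ refl = a≢b refl
... | inj₁ refl | inj₂ cb = a≁b cb
... | inj₂ ca | inj₁ refl = a≁b (Position.Adj-sym G ca)
... | inj₂ ca | inj₂ cb = no-path (_ , Position.Adj-sym G ca , cb)

module Caterpillar {t : ℕ} (ks : Vec ℕ (suc t)) where
  open Labelled (catTree ks) public using (Leaf)
  open Strategy (catTree ks) public using (Fork)

  Pendant : Fin (suc t) → Set
  Pendant j = Fin (Vec.lookup ks j)

  pendant? : ∀ j → Pendant j ⊎ ¬ Pendant j
  pendant? j with Vec.lookup ks j
  ... | zero = inj₂ λ ()
  ... | suc _ = inj₁ Fin.zero

  pendant-leaf : ∀ {j} (i : Pendant j) → Leaf (inj₂ (j , i)) (inj₁ j)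
  pendant-leaf {j} i = record
    { stem = inj₂ (j , i) , inj₂ refl
    ; only-stem = λ { (inj₁ _ , inj₁ ()) ; (inj₁ _ , inj₂ ()) ; (inj₂ _ , inj₁ ()) ; (inj₂ _ , inj₂ refl) → refl } }

-- The spine may end in a vertex without attached leaves; that vertex then serves as a leaf of the
-- fork.
first-leaf : ∀ {t} (ks : Vec ℕ (2 + t)) → let open Caterpillar ks in
             ¬ Pendant Fin.zero → Leaf (inj₁ Fin.zero) (inj₁ (Fin.suc Fin.zero))
first-leaf ks bare = record
  { stem = inj₁ Fin.zero , inj₁ refl
  ; only-stem = λ { (inj₁ Fin.zero , inj₁ refl) → refl ; (inj₁ (Fin.suc _) , inj₁ ()) ; (inj₁ _ , inj₂ ())
                  ; (inj₂ (Fin.zero , i) , _) → contradiction i bare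
                  ; (inj₂ (Fin.suc _ , _) , inj₁ ()) ; (inj₂ (Fin.suc _ , _) , inj₂ ()) } }

last-leaf : ∀ {t} (ks : Vec ℕ (2 + t)) → let open Caterpillar ks in
            ¬ Pendant (fromℕ (suc t)) → Leaf (inj₁ (fromℕ (suc t))) (inj₁ (inject₁ (fromℕ t)))
last-leaf {t} ks bare = record { stem = inj₁ (fromℕ t) , inj₂ refl ; only-stem = λ { {a} (e , p) → only e p } }
  where
  open Position (cat ks) using (Joins)
  only : ∀ e {a} → Joins e (inj₁ (fromℕ (suc t))) a → a ≡ inj₁ (inject₁ (fromℕ t))
  only (inj₁ i) (inj₁ eq) = contradiction (sym (inj₁-injective (,-injectiveˡ eq))) Fin.fromℕ≢inject₁
  only (inj₁ i) (inj₂ eq) with refl ← Fin.suc-injective (inj₁-injective (,-injectiveʳ eq)) =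
    sym (,-injectiveˡ eq)
  only (inj₂ (j , i)) (inj₁ eq) = contradiction (subst (Caterpillar.Pendant ks) (inj₁-injective (,-injectiveˡ eq)) i) bare

-- Each spine end contributes a pendant edge: one of its own leaves if there are any, otherwise the
-- last spine edge. The two edges can meet only if the spine is so short that the tree is a star.
cat-fork : ∀ t (ks : Vec ℕ (suc t)) → DiamGe3 (cat ks) →
           ∃[ v ] ∃[ u ] ∃[ v′ ] ∃[ u′ ] Caterpillar.Fork ks v u v′ u′
cat-fork zero ks diam = contradiction diam (dominating⇒¬diamGe3 (cat ks) {inj₁ Fin.zero}
  λ { (inj₁ Fin.zero) → inj₁ refl ; (inj₂ (Fin.zero , i)) → inj₂ (inj₂ (Fin.zero , i) , inj₁ refl) })
cat-fork (suc t) ks diam = ends-of (pendant? Fin.zero) (pendant? (fromℕ (suc t)))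
  where
  open Caterpillar ks
  ¬dominated : ∀ c → ¬ (∀ a → a ≡ c ⊎ Adj (cat ks) c a)
  ¬dominated c dom = dominating⇒¬diamGe3 (cat ks) dom diam
  ends-of : Pendant Fin.zero ⊎ ¬ Pendant Fin.zero → Pendant (fromℕ (suc t)) ⊎ ¬ Pendant (fromℕ (suc t)) →
            ∃[ v ] ∃[ u ] ∃[ v′ ] ∃[ u′ ] Fork v u v′ u′
  ends-of (inj₁ i) (inj₁ i′) = _ , _ , _ , _ , record
    { leaf = pendant-leaf i ; leaf′ = pendant-leaf i′ ; u≢u′ = λ () ; v≢u′ = λ () ; v′≢u = λ () }
  ends-of (inj₁ i) (inj₂ bare) = _ , _ , _ , _ , record
    { leaf = pendant-leaf i ; leaf′ = last-leaf ks bare ; u≢u′ = distinct t ks ¬dominated bare ; v≢u′ = λ () ; v′≢u = λ () }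
    where
    -- Generalised over `t` so that the spine length can be matched on. The stems coincide only for
    -- two spine vertices, and the tree is then a star about the first.
    distinct : ∀ t (ks : Vec ℕ (2 + t)) → (∀ c → ¬ (∀ a → a ≡ c ⊎ Adj (cat ks) c a)) →
               ¬ Caterpillar.Pendant ks (fromℕ (suc t)) →
               _≢_ {A = CatV ks} (inj₁ Fin.zero) (inj₁ (inject₁ (fromℕ t)))
    distinct zero ks ¬dom bare _ = ¬dom (inj₁ Fin.zero) λ
      { (inj₁ Fin.zero) → inj₁ refl ; (inj₁ (Fin.suc Fin.zero)) → inj₂ (inj₁ Fin.zero , inj₁ refl)
      ; (inj₂ (Fin.zero , i)) → inj₂ (inj₂ (Fin.zero , i) , inj₁ refl)
      ; (inj₂ (Fin.suc Fin.zero , i)) → contradiction i bare }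
    distinct (suc _) _ _ _ ()
  ends-of (inj₂ bare) (inj₁ i) = _ , _ , _ , _ , record
    { leaf = first-leaf ks bare ; leaf′ = pendant-leaf i ; u≢u′ = distinct t ks ¬dominated bare ; v≢u′ = λ () ; v′≢u = λ () }
    where
    distinct : ∀ t (ks : Vec ℕ (2 + t)) → (∀ c → ¬ (∀ a → a ≡ c ⊎ Adj (cat ks) c a)) →
               ¬ Caterpillar.Pendant ks Fin.zero →
               _≢_ {A = CatV ks} (inj₁ (Fin.suc Fin.zero)) (inj₁ (fromℕ (suc t)))
    distinct zero ks ¬dom bare _ = ¬dom (inj₁ (Fin.suc Fin.zero)) λ
      { (inj₁ Fin.zero) → inj₂ (inj₁ Fin.zero , inj₂ refl) ; (inj₁ (Fin.suc Fin.zero)) → inj₁ refl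
      ; (inj₂ (Fin.zero , i)) → contradiction i bare
      ; (inj₂ (Fin.suc Fin.zero , i)) → inj₂ (inj₂ (Fin.suc Fin.zero , i) , inj₁ refl) }
    distinct (suc _) _ _ _ ()
  ends-of (inj₂ bare) (inj₂ bare′) = _ , _ , _ , _ , record
    { leaf = first-leaf ks bare ; leaf′ = last-leaf ks bare′
    ; u≢u′ = u≢u′ t ks ¬dominated bare bare′ ; v≢u′ = v≢u′ t ks ¬dominated bare bare′ ; v′≢u = v′≢u t ks ¬dominated bare bare′ }
    where
    Bare : ∀ t → Vec ℕ (2 + t) → Set → Set
    Bare t ks A = (∀ c → ¬ (∀ a → a ≡ c ⊎ Adj (cat ks) c a)) →
      ¬ Caterpillar.Pendant ks Fin.zero → ¬ Caterpillar.Pendant ks (fromℕ (suc t)) → A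
    two : ∀ (ks : Vec ℕ 2) → Bare 0 ks ⊥
    two ks ¬dom bare bare′ = ¬dom (inj₁ Fin.zero) λ
      { (inj₁ Fin.zero) → inj₁ refl ; (inj₁ (Fin.suc Fin.zero)) → inj₂ (inj₁ Fin.zero , inj₁ refl)
      ; (inj₂ (Fin.zero , i)) → contradiction i bare
      ; (inj₂ (Fin.suc Fin.zero , i)) → contradiction i bare′ }
    u≢u′ : ∀ t ks → Bare t ks (_≢_ {A = CatV ks} (inj₁ (Fin.suc Fin.zero)) (inj₁ (inject₁ (fromℕ t))))
    u≢u′ zero ks ¬dom bare bare′ ()
    -- Three spine vertices with bare ends form a star about the middle one.
    u≢u′ (suc zero) ks ¬dom bare bare′ _ = ¬dom (inj₁ (Fin.suc Fin.zero)) λ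
      { (inj₁ Fin.zero) → inj₂ (inj₁ Fin.zero , inj₂ refl) ; (inj₁ (Fin.suc Fin.zero)) → inj₁ refl
      ; (inj₁ (Fin.suc (Fin.suc Fin.zero))) → inj₂ (inj₁ (Fin.suc Fin.zero) , inj₁ refl)
      ; (inj₂ (Fin.zero , i)) → contradiction i bare
      ; (inj₂ (Fin.suc Fin.zero , i)) → inj₂ (inj₂ (Fin.suc Fin.zero , i) , inj₁ refl)
      ; (inj₂ (Fin.suc (Fin.suc Fin.zero) , i)) → contradiction i bare′ }
    u≢u′ (suc (suc t)) ks ¬dom bare bare′ ()
    v≢u′ : ∀ t ks → Bare t ks (_≢_ {A = CatV ks} (inj₁ Fin.zero) (inj₁ (inject₁ (fromℕ t))))
    v≢u′ zero ks ¬dom bare bare′ _ = two ks ¬dom bare bare′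
    v≢u′ (suc t) ks ¬dom bare bare′ ()
    v′≢u : ∀ t ks → Bare t ks (_≢_ {A = CatV ks} (inj₁ (fromℕ (suc t))) (inj₁ (Fin.suc Fin.zero)))
    v′≢u zero ks ¬dom bare bare′ _ = two ks ¬dom bare bare′
    v′≢u (suc t) ks ¬dom bare bare′ ()

theorem5 : ∀ (t : ℕ) (ks : Vec ℕ (suc t)) → DiamGe3 (cat ks) →
    ∀ (p : Player) → BobWins (cat ks) p (empty (cat ks))
theorem5 t ks diam =
  let (_ , _ , _ , _ , fk) = cat-fork t ks diam in Conclusion.fork⇒bobWins (catTree ks) fk
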